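{- Assume $U,V\subseteq\{0,1\}^n$ are disjoint and non-empty and $U$ is closed upwards (or $V$ downwards). Let $C$ be a monotone real circuit of size $s$ separating $U$ from $V$. Then for every $0<\epsilon<\frac12$ there is a monotone circuit with a local oracle (CLO) $D$ separating $U$ from $V$, having size $s\left(\frac n\epsilon\right)^{O(1)}$ and locality $\mu\le s\epsilon$. In particular, for any $\mu>0$ there is a monotone CLO separating $U$ from $V$ with locality $\le\mu$ and size $(n\,s\,\mu^{ -1})^{O(1)}$.
   Context: $O(1)$ denotes an absolute constant; orders on $\{0,1\}^n$ are coordinatewise. A monotone real circuit is a circuit with inputs $x_1,\dots,x_n\in\{0,1\}$ whose gates compute arbitrary non-decreasing real functions (of at most two real arguments); its size is the number of its nodes. It separates $U$ from $V$ if it outputs $1$ on all of $U$ and $0$ on all of $V$. Monotone CLO. A monotone circuit with a local oracle separating $U$ from $V$ consists of (1) a monotone Boolean circuit $D(x_1,\dots,x_n,y_1,\dots,y_e)$ and (2) a set of combinatorial rectangles $U_j\times V_j\subseteq U\times V$, $j\le e$ (oracle rectangles), such that (3) for all monotone Boolean functions $f_j:\{0,1\}^n\to\{0,1\}$, $j\le e$, with $f_j(U_j)\subseteq\{1\}$ and $f_j(V_j)\subseteq\{0\}$, the function $\overline x\mapsto D(\overline x,f_1(\overline x),\dots,f_e(\overline x))$ is identically $1$ on $U$ and identically $0$ on $V$. Its size is the size (number of nodes) of $D$ and its locality is $|\bigcup_{j\le e}U_j\times V_j|/|U\times V|$. -}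

module Defs where

import Algebra.Bundles as Bundles
import Algebra.Properties.AbelianGroup as AbelianGroupProperties
import Algebra.Properties.CommutativeSemigroup as CommutativeSemigroupProperties
import Algebra.Properties.Group as GroupProperties
import Algebra.Properties.RingWithoutOne as RingWithoutOneProperties
open import Data.Bool.Base as Bool using (Bool; true; false; T; _∧_; _∨_)
open import Data.Bool.Properties using (T-∧)
open import Data.Bool.ListAction using (any)
open import Data.Fin.Base using (Fin)
open import Data.Integer.Base using (+_)
open import Data.List.Base as List using (List; []; _∷_; _++_; length; filterᵇ; cartesianProduct; allFin)
open import Data.List.Membership.Propositional using () renaming (_∈_ to _∈ˡ_)
open import Data.List.Membership.Propositional.Properties
  using (∈-map⁺; ∈-++⁺ˡ; ∈-++⁺ʳ; ∈-filter⁺; ∈-cartesianProduct⁺; ∈-length)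
open import Data.List.Relation.Unary.Any using (here)
open import Data.Nat.Base as ℕ using (ℕ; zero; suc)
import Data.Nat.Properties as ℕₚ
open import Data.Product using (∃-syntax; _×_; _,_; proj₁; proj₂)
open import Data.Rational.Base as ℚ using (ℚ; 0ℚ; 1ℚ; ½; _+_; _*_; _-_; -_; _≤_; _<_; _⊔_; ∣_∣; 1/_; _/_)
import Data.Rational.Properties as ℚₚ
open import Data.Sum using (inj₁; inj₂)
open import Data.Vec.Base as Vec using (Vec; []; _∷_; lookup)
open import Data.Vec.Relation.Binary.Pointwise.Inductive using (Pointwise)
open import Function.Base using (_∘_)
open import Function.Bundles using (Equivalence)
open import Relation.Binary.PropositionalEquality using (_≡_; refl; sym; trans; cong; cong₂; subst)
open import Relation.Nullary using (¬_)
open import Relation.Nullary.Decidable using (T?)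

-- Real numbers: Cauchy sequences of rationals, with equality _≃ℝ_.
-- All operations are pointwise.

IsCauchy : (ℕ → ℚ) → Set
IsCauchy x = ∀ δ → 0ℚ < δ → ∃[ N ] (∀ m n → N ℕ.≤ m → N ℕ.≤ n → ∣ x m - x n ∣ ≤ δ)

record ℝ : Set where
  constructor mkℝ
  field
    seq    : ℕ → ℚ
    cauchy : IsCauchy seq

open ℝ public

infix 4 _≤ℝ_ _<ℝ_ _≃ℝ_

_≤ℝ_ : ℝ → ℝ → Set
x ≤ℝ y = ∀ δ → 0ℚ < δ → ∃[ N ] (∀ n → N ℕ.≤ n → seq x n ≤ seq y n + δ)

_<ℝ_ : ℝ → ℝ → Set
x <ℝ y = ∃[ δ ] (0ℚ < δ × ∃[ N ] (∀ n → N ℕ.≤ n → seq x n + δ ≤ seq y n))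

_≃ℝ_ : ℝ → ℝ → Set
x ≃ℝ y = x ≤ℝ y × y ≤ℝ x

private
  module +ᴳ = GroupProperties ℚₚ.+-0-group
  module +ᴬ = AbelianGroupProperties ℚₚ.+-0-abelianGroup
  module *ᶜ = CommutativeSemigroupProperties
    (Bundles.CommutativeMonoid.commutativeSemigroup ℚₚ.*-1-commutativeMonoid)
  module +*ᴿ = RingWithoutOneProperties (Bundles.Ring.ringWithoutOne ℚₚ.+-*-ring)

  p-p≡0 : ∀ p → p - p ≡ 0ℚ
  p-p≡0 = ℚₚ.+-inverseʳ

  0<* : ∀ {p q} → 0ℚ < p → 0ℚ < q → 0ℚ < p * q
  0<* {p} {q} 0<p 0<q =
    ℚₚ.positive⁻¹ (p * q) {{ℚₚ.pos*pos⇒pos p {{ℚ.positive 0<p}} q {{ℚ.positive 0<q}}}}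

  0<1/ : ∀ {p} (0<p : 0ℚ < p) → 0ℚ < (1/ p) {{ℚ.>-nonZero 0<p}}
  0<1/ {p} 0<p = ℚₚ.positive⁻¹ _ {{ℚₚ.1/pos⇒pos p {{ℚ.positive 0<p}}}}

  *-mono : ∀ {p q r s} → 0ℚ ≤ q → 0ℚ ≤ r → p ≤ q → r ≤ s → p * r ≤ q * s
  *-mono {p} {q} {r} {s} 0≤q 0≤r p≤q r≤s = ℚₚ.≤-trans
    (ℚₚ.*-monoʳ-≤-nonNeg r {{ℚ.nonNegative 0≤r}} p≤q)
    (ℚₚ.*-monoˡ-≤-nonNeg q {{ℚ.nonNegative 0≤q}} r≤s)

  p≤∣p∣ : ∀ p → p ≤ ∣ p ∣
  p≤∣p∣ p with ℚₚ.≤-total 0ℚ p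
  ... | inj₁ 0≤p = ℚₚ.≤-reflexive (sym (ℚₚ.0≤p⇒∣p∣≡p 0≤p))
  ... | inj₂ p≤0 = ℚₚ.≤-trans p≤0 (ℚₚ.0≤∣p∣ p)

  q+[p-q]≡p : ∀ p q → q + (p - q) ≡ p
  q+[p-q]≡p p q = trans (sym (ℚₚ.+-assoc q p (- q))) (+ᴬ.xyx⁻¹≈y q p)

  [p-q]+[q-r]≡p-r : ∀ p q r → (p - q) + (q - r) ≡ p - r
  [p-q]+[q-r]≡p-r p q r = trans (sym (ℚₚ.+-assoc (p - q) q (- r)))
    (cong (_- r) (+ᴳ.//-rightDividesˡ q p))

  ∣p-q∣≤⇒p≤q+ : ∀ p q δ → ∣ p - q ∣ ≤ δ → p ≤ q + δ
  ∣p-q∣≤⇒p≤q+ p q δ h = subst (_≤ q + δ) (q+[p-q]≡p p q)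
    (ℚₚ.+-monoʳ-≤ q (ℚₚ.≤-trans (p≤∣p∣ (p - q)) h))

  p≤q+⇒p-q≤ : ∀ p q δ → p ≤ q + δ → p - q ≤ δ
  p≤q+⇒p-q≤ p q δ h = subst (p - q ≤_) (+ᴬ.xyx⁻¹≈y q δ) (ℚₚ.+-monoˡ-≤ (- q) h)

  ∣p-q∣≤ : ∀ p q δ → p ≤ q + δ → q ≤ p + δ → ∣ p - q ∣ ≤ δ
  ∣p-q∣≤ p q δ h k with ℚₚ.∣p∣≡p∨∣p∣≡-p (p - q)
  ... | inj₁ eq = subst (_≤ δ) (sym eq) (p≤q+⇒p-q≤ p q δ h)
  ... | inj₂ eq = subst (_≤ δ) (trans (sym (+ᴳ.⁻¹-anti-homo-// p q)) (sym eq)) (p≤q+⇒p-q≤ q p δ k)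

  bounded : ∀ x → IsCauchy x →
            ∃[ B ] (0ℚ < B × ∃[ N ] (∀ n → N ℕ.≤ n → ∣ x n ∣ ≤ B))
  bounded x c with c 1ℚ (ℚₚ.positive⁻¹ 1ℚ)
  ... | N , h = ∣ x N ∣ + 1ℚ
              , ℚₚ.<-≤-trans (ℚₚ.positive⁻¹ 1ℚ)
                  (subst (_≤ ∣ x N ∣ + 1ℚ) (ℚₚ.+-identityˡ 1ℚ) (ℚₚ.+-monoˡ-≤ 1ℚ (ℚₚ.0≤∣p∣ (x N))))
              , N , λ n N≤n → subst (λ z → ∣ z ∣ ≤ ∣ x N ∣ + 1ℚ) (q+[p-q]≡p (x n) (x N))
                  (ℚₚ.≤-trans (ℚₚ.∣p+q∣≤∣p∣+∣q∣ (x N) (x n - x N))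
                    (ℚₚ.+-monoʳ-≤ ∣ x N ∣ (h n N N≤n ℕₚ.≤-refl)))

  abstract
    const-cauchy : ∀ q → IsCauchy (λ _ → q)
    const-cauchy q δ 0<δ = 0 , λ _ _ _ _ →
      subst (λ z → ∣ z ∣ ≤ δ) (sym (p-p≡0 q)) (ℚₚ.<⇒≤ 0<δ)

    *-cauchy : ∀ x y → IsCauchy x → IsCauchy y → IsCauchy (λ n → x n * y n)
    *-cauchy x y cx cy δ 0<δ = M , bound
      where
      B D 1/B 1/D : ℚ
      B = proj₁ (bounded x cx)
      D = proj₁ (bounded y cy)
      0<B : 0ℚ < B
      0<B = proj₁ (proj₂ (bounded x cx))
      0<D : 0ℚ < D
      0<D = proj₁ (proj₂ (bounded y cy))
      1/B = (1/ B) {{ℚ.>-nonZero 0<B}}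
      1/D = (1/ D) {{ℚ.>-nonZero 0<D}}

      x-stable : ∃[ N ] (∀ m n → N ℕ.≤ m → N ℕ.≤ n → ∣ x m - x n ∣ ≤ ½ * δ * 1/D)
      x-stable = cx (½ * δ * 1/D) (0<* (0<* (ℚₚ.positive⁻¹ ½) 0<δ) (0<1/ 0<D))
      y-stable : ∃[ N ] (∀ m n → N ℕ.≤ m → N ℕ.≤ n → ∣ y m - y n ∣ ≤ ½ * δ * 1/B)
      y-stable = cy (½ * δ * 1/B) (0<* (0<* (ℚₚ.positive⁻¹ ½) 0<δ) (0<1/ 0<B))

      N₁ N₂ N₃ N₄ M : ℕ
      N₁ = proj₁ (proj₂ (proj₂ (bounded x cx)))
      N₂ = proj₁ (proj₂ (proj₂ (bounded y cy)))
      N₃ = proj₁ x-stable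
      N₄ = proj₁ y-stable
      M = (N₁ ℕ.⊔ N₂) ℕ.⊔ (N₃ ℕ.⊔ N₄)

      hx : ∀ n → N₁ ℕ.≤ n → ∣ x n ∣ ≤ B
      hx = proj₂ (proj₂ (proj₂ (bounded x cx)))
      hy : ∀ n → N₂ ℕ.≤ n → ∣ y n ∣ ≤ D
      hy = proj₂ (proj₂ (proj₂ (bounded y cy)))

      ½δ+½δ : ½ * δ + ½ * δ ≡ δ
      ½δ+½δ = trans (sym (ℚₚ.*-distribʳ-+ δ ½ ½)) (ℚₚ.*-identityˡ δ)

      cancel : ∀ C (0<C : 0ℚ < C) → C * (½ * δ * (1/ C) {{ℚ.>-nonZero 0<C}}) ≡ ½ * δ
      cancel C 0<C = trans (*ᶜ.x∙yz≈y∙xz C (½ * δ) C⁻¹)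
        (trans (cong (½ * δ *_) (ℚₚ.*-inverseʳ C {{ℚ.>-nonZero 0<C}})) (ℚₚ.*-identityʳ (½ * δ)))
        where
        C⁻¹ : ℚ
        C⁻¹ = (1/ C) {{ℚ.>-nonZero 0<C}}

      split : ∀ a b c d → a * c - b * d ≡ a * (c - d) + d * (a - b)
      split a b c d = sym (trans
        (cong₂ _+_ (+*ᴿ.x[y-z]≈xy-xz a c d)
          (trans (ℚₚ.*-comm d (a - b)) (+*ᴿ.[y-z]x≈yx-zx d a b)))
        ([p-q]+[q-r]≡p-r (a * c) (a * d) (b * d)))

      half : ∀ p C q r → 0ℚ ≤ C → ∣ p ∣ ≤ C → ∣ q ∣ ≤ r → ∣ p * q ∣ ≤ C * r
      half p C q r 0≤C hp hq = subst (_≤ C * r) (sym (ℚₚ.∣p*q∣≡∣p∣*∣q∣ p q))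
        (*-mono 0≤C (ℚₚ.0≤∣p∣ q) hp hq)

      bound : ∀ m n → M ℕ.≤ m → M ℕ.≤ n → ∣ x m * y m - x n * y n ∣ ≤ δ
      bound m n M≤m M≤n = begin
        ∣ x m * y m - x n * y n ∣                           ≡⟨ cong ∣_∣ (split (x m) (x n) (y m) (y n)) ⟩
        ∣ x m * (y m - y n) + y n * (x m - x n) ∣            ≤⟨ ℚₚ.∣p+q∣≤∣p∣+∣q∣ (x m * (y m - y n)) (y n * (x m - x n)) ⟩
        ∣ x m * (y m - y n) ∣ + ∣ y n * (x m - x n) ∣        ≤⟨ ℚₚ.+-mono-≤
            (half (x m) B (y m - y n) (½ * δ * 1/B) (ℚₚ.<⇒≤ 0<B)
              (hx m (ℕₚ.m⊔n≤o⇒m≤o N₁ N₂ (ll M≤m))) (proj₂ y-stable m n (rr M≤m) (rr M≤n)))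
            (half (y n) D (x m - x n) (½ * δ * 1/D) (ℚₚ.<⇒≤ 0<D)
              (hy n (ℕₚ.m⊔n≤o⇒n≤o N₁ N₂ (ll M≤n))) (proj₂ x-stable m n (rl M≤m) (rl M≤n))) ⟩
        B * (½ * δ * 1/B) + D * (½ * δ * 1/D)                ≡⟨ cong₂ _+_ (cancel B 0<B) (cancel D 0<D) ⟩
        ½ * δ + ½ * δ                                       ≡⟨ ½δ+½δ ⟩
        δ                                                   ∎
        where
        open ℚₚ.≤-Reasoning
        ll : ∀ {k} → M ℕ.≤ k → N₁ ℕ.⊔ N₂ ℕ.≤ k
        ll = ℕₚ.m⊔n≤o⇒m≤o (N₁ ℕ.⊔ N₂) (N₃ ℕ.⊔ N₄)
        rl : ∀ {k} → M ℕ.≤ k → N₃ ℕ.≤ k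
        rl = ℕₚ.m⊔n≤o⇒m≤o N₃ N₄ ∘ ℕₚ.m⊔n≤o⇒n≤o (N₁ ℕ.⊔ N₂) (N₃ ℕ.⊔ N₄)
        rr : ∀ {k} → M ℕ.≤ k → N₄ ℕ.≤ k
        rr = ℕₚ.m⊔n≤o⇒n≤o N₃ N₄ ∘ ℕₚ.m⊔n≤o⇒n≤o (N₁ ℕ.⊔ N₂) (N₃ ℕ.⊔ N₄)

  ⊔-mono+ : ∀ a b c d δ → a ≤ c + δ → b ≤ d + δ → a ⊔ b ≤ (c ⊔ d) + δ
  ⊔-mono+ a b c d δ h k = ℚₚ.⊔-lub
    (ℚₚ.≤-trans h (ℚₚ.+-monoˡ-≤ δ (ℚₚ.p≤p⊔q c d)))
    (ℚₚ.≤-trans k (ℚₚ.+-monoˡ-≤ δ (ℚₚ.p≤q⊔p c d)))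

  abstract
    ⊔-cauchy : ∀ x y → IsCauchy x → IsCauchy y → IsCauchy (λ n → x n ⊔ y n)
    ⊔-cauchy x y cx cy δ 0<δ with cx δ 0<δ | cy δ 0<δ
    ... | M , h | N , k = M ℕ.⊔ N , λ m n p q → ∣p-q∣≤ (x m ⊔ y m) (x n ⊔ y n) δ
      (⊔-mono+ (x m) (y m) (x n) (y n) δ
        (∣p-q∣≤⇒p≤q+ (x m) (x n) δ (h m n (l p) (l q)))
        (∣p-q∣≤⇒p≤q+ (y m) (y n) δ (k m n (r p) (r q))))
      (⊔-mono+ (x n) (y n) (x m) (y m) δ
        (∣p-q∣≤⇒p≤q+ (x n) (x m) δ (h n m (l q) (l p)))
        (∣p-q∣≤⇒p≤q+ (y n) (y m) δ (k n m (r q) (r p))))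
      where
      l : ∀ {i} → M ℕ.⊔ N ℕ.≤ i → M ℕ.≤ i
      l = ℕₚ.m⊔n≤o⇒m≤o M N
      r : ∀ {i} → M ℕ.⊔ N ℕ.≤ i → N ℕ.≤ i
      r = ℕₚ.m⊔n≤o⇒n≤o M N

  0<⊔ : ∀ {d} → 0ℚ < d → ∀ p → 0ℚ < d ⊔ p
  0<⊔ {d} 0<d p = ℚₚ.<-≤-trans 0<d (ℚₚ.p≤p⊔q d p)

  -- For a ≥ d > 0 and b ≥ d > 0:  ∣ a⁻¹ - b⁻¹ ∣ = ∣ b - a ∣ a⁻¹ b⁻¹ ≤ ∣ b - a ∣ d⁻²
  abstract
    clamped-inv-cauchy : ∀ {d} (0<d : 0ℚ < d) x → IsCauchy x →
                         IsCauchy (λ n → (1/ (d ⊔ x n)) {{ℚ.>-nonZero (0<⊔ 0<d (x n))}})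
    clamped-inv-cauchy {d} 0<d x cx δ 0<δ
      = proj₁ stable , bound
      where
      a : ℕ → ℚ
      a n = d ⊔ x n
      stable : ∃[ N ] (∀ m n → N ℕ.≤ m → N ℕ.≤ n → ∣ a m - a n ∣ ≤ δ * (d * d))
      stable = ⊔-cauchy (λ _ → d) x (const-cauchy d) cx (δ * (d * d)) (0<* 0<δ (0<* 0<d 0<d))
      0<a : ∀ n → 0ℚ < a n
      0<a n = 0<⊔ 0<d (x n)
      a⁻¹ : ℕ → ℚ
      a⁻¹ n = (1/ a n) {{ℚ.>-nonZero (0<a n)}}
      aa⁻¹ : ∀ n → a n * a⁻¹ n ≡ 1ℚ
      aa⁻¹ n = ℚₚ.*-inverseʳ (a n) {{ℚ.>-nonZero (0<a n)}}
      0≤a⁻¹ : ∀ n → 0ℚ ≤ a⁻¹ n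
      0≤a⁻¹ n = ℚₚ.<⇒≤ (0<1/ (0<a n))

      da⁻¹≤1 : ∀ n → d * a⁻¹ n ≤ 1ℚ
      da⁻¹≤1 n = subst (d * a⁻¹ n ≤_) (aa⁻¹ n)
        (ℚₚ.*-monoʳ-≤-nonNeg (a⁻¹ n) {{ℚ.nonNegative (0≤a⁻¹ n)}} (ℚₚ.p≤p⊔q d (x n)))

      diff : ∀ m n → a⁻¹ m - a⁻¹ n ≡ (a n - a m) * (a⁻¹ m * a⁻¹ n)
      diff m n = sym (trans
        (+*ᴿ.[y-z]x≈yx-zx (a⁻¹ m * a⁻¹ n) (a n) (a m))
        (cong₂ _-_
          (trans (*ᶜ.x∙yz≈xz∙y (a n) (a⁻¹ m) (a⁻¹ n))
            (trans (cong (_* a⁻¹ m) (aa⁻¹ n)) (ℚₚ.*-identityˡ (a⁻¹ m))))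
          (trans (sym (ℚₚ.*-assoc (a m) (a⁻¹ m) (a⁻¹ n)))
            (trans (cong (_* a⁻¹ n) (aa⁻¹ m)) (ℚₚ.*-identityˡ (a⁻¹ n))))))

      0≤δ : 0ℚ ≤ δ
      0≤δ = ℚₚ.<⇒≤ 0<δ

      bound : ∀ m n → proj₁ stable ℕ.≤ m → proj₁ stable ℕ.≤ n → ∣ a⁻¹ m - a⁻¹ n ∣ ≤ δ
      bound m n N≤m N≤n = begin
        ∣ a⁻¹ m - a⁻¹ n ∣                          ≡⟨ cong ∣_∣ (diff m n) ⟩
        ∣ (a n - a m) * (a⁻¹ m * a⁻¹ n) ∣           ≡⟨ ℚₚ.∣p*q∣≡∣p∣*∣q∣ (a n - a m) (a⁻¹ m * a⁻¹ n) ⟩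
        ∣ a n - a m ∣ * ∣ a⁻¹ m * a⁻¹ n ∣           ≡⟨ cong (∣ a n - a m ∣ *_) (ℚₚ.0≤p⇒∣p∣≡p 0≤uv) ⟩
        ∣ a n - a m ∣ * (a⁻¹ m * a⁻¹ n)             ≤⟨ ℚₚ.*-monoʳ-≤-nonNeg (a⁻¹ m * a⁻¹ n)
                                                        {{ℚ.nonNegative 0≤uv}} (proj₂ stable n m N≤n N≤m) ⟩
        δ * (d * d) * (a⁻¹ m * a⁻¹ n)               ≡⟨ lem δ d (a⁻¹ m) (a⁻¹ n) ⟩
        δ * (d * a⁻¹ m * (d * a⁻¹ n))               ≤⟨ ℚₚ.*-monoˡ-≤-nonNeg δ {{ℚ.nonNegative 0≤δ}}
                                                        (*-mono (ℚₚ.<⇒≤ (ℚₚ.positive⁻¹ 1ℚ))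
                                                          (ℚₚ.<⇒≤ (0<* 0<d (0<1/ (0<a n))))
                                                          (da⁻¹≤1 m) (da⁻¹≤1 n)) ⟩
        δ * (1ℚ * 1ℚ)                              ≡⟨ ℚₚ.*-identityʳ δ ⟩
        δ                                          ∎
        where
        open ℚₚ.≤-Reasoning
        0≤uv : 0ℚ ≤ a⁻¹ m * a⁻¹ n
        0≤uv = ℚₚ.<⇒≤ (0<* (0<1/ (0<a m)) (0<1/ (0<a n)))
        lem : ∀ p q u v → p * (q * q) * (u * v) ≡ p * (q * u * (q * v))
        lem p q u v = trans (ℚₚ.*-assoc p (q * q) (u * v)) (cong (p *_) (*ᶜ.interchange q q u v))

infixl 7 _*ℝ_
infixl 6 _⊔ℝ_
infixr 8 _^ℝ_
infix  9 _⁻¹[_]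

fromℚ : ℚ → ℝ
fromℚ q = mkℝ (λ _ → q) (const-cauchy q)

fromℕ : ℕ → ℝ
fromℕ k = fromℚ (+ k / 1)

0ℝ 1ℝ ½ℝ : ℝ
0ℝ = fromℚ 0ℚ
1ℝ = fromℚ 1ℚ
½ℝ = fromℚ ½

_*ℝ_ : ℝ → ℝ → ℝ
x *ℝ y = mkℝ (λ n → seq x n * seq y n) (*-cauchy (seq x) (seq y) (cauchy x) (cauchy y))

_⊔ℝ_ : ℝ → ℝ → ℝ
x ⊔ℝ y = mkℝ (λ n → seq x n ⊔ seq y n) (⊔-cauchy (seq x) (seq y) (cauchy x) (cauchy y))

_^ℝ_ : ℝ → ℕ → ℝ
x ^ℝ zero  = 1ℝ
x ^ℝ suc k = x *ℝ x ^ℝ k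

-- A proof of 0 < x supplies some d > 0 with seq x n ≥ d for all large n, so
-- replacing seq x n by d ⊔ seq x n leaves x unchanged as a real number and
-- makes every term invertible.
_⁻¹[_] : (x : ℝ) → 0ℝ <ℝ x → ℝ
x ⁻¹[ d , 0<d , _ ] =
  mkℝ (λ n → (1/ (d ⊔ seq x n)) {{ℚ.>-nonZero (0<⊔ 0<d (seq x n))}})
      (clamped-inv-cauchy 0<d (seq x) (cauchy x))

Cube : ℕ → Set
Cube n = Vec Bool n

_≤ᶜ_ : ∀ {n} → Cube n → Cube n → Set
_≤ᶜ_ = Pointwise Bool._≤_

cube : ∀ n → List (Cube n)
cube zero    = [] ∷ []
cube (suc n) = List.map (false ∷_) (cube n) ++ List.map (true ∷_) (cube n)

-- Every subset of a finite set is decidable, hence given by a Boolean function.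
Subset : ℕ → Set
Subset n = Cube n → Bool

infix 4 _∈_ _⊆_

_∈_ : ∀ {n} → Cube n → Subset n → Set
x ∈ A = T (A x)

_⊆_ : ∀ {n} → Subset n → Subset n → Set
A ⊆ B = ∀ x → x ∈ A → x ∈ B

Nonempty : ∀ {n} → Subset n → Set
Nonempty A = ∃[ x ] x ∈ A

Disjoint : ∀ {n} → Subset n → Subset n → Set
Disjoint A B = ∀ x → x ∈ A → ¬ x ∈ B

UpwardClosed : ∀ {n} → Subset n → Set
UpwardClosed A = ∀ x y → x ≤ᶜ y → x ∈ A → y ∈ A

DownwardClosed : ∀ {n} → Subset n → Set
DownwardClosed A = ∀ x y → x ≤ᶜ y → y ∈ A → x ∈ A

Monotone : ∀ {n} → (Cube n → Bool) → Set
Monotone f = ∀ x y → x ≤ᶜ y → f x Bool.≤ f y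

PairSet : ℕ → Set
PairSet n = Cube n × Cube n → Bool

_⊗_ : ∀ {n} → Subset n → Subset n → PairSet n
(A ⊗ B) (x , y) = A x ∧ B y

card : ∀ {n} → PairSet n → ℕ
card {n} R = length (filterᵇ R (cartesianProduct (cube n) (cube n)))

∈-cube : ∀ {n} (x : Cube n) → x ∈ˡ cube n
∈-cube []          = here refl
∈-cube (false ∷ x) = ∈-++⁺ˡ (∈-map⁺ (false ∷_) (∈-cube x))
∈-cube {suc n} (true ∷ x) =
  ∈-++⁺ʳ (List.map (false ∷_) (cube n)) (∈-map⁺ (true ∷_) (∈-cube x))

card-⊗-nonZero : ∀ {n} (A B : Subset n) → Nonempty A → Nonempty B → ℕ.NonZero (card (A ⊗ B))
card-⊗-nonZero A B (x , x∈A) (y , y∈B) = ℕ.>-nonZero (∈-length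
  (∈-filter⁺ (T? ∘ (A ⊗ B)) (∈-cartesianProduct⁺ (∈-cube x) (∈-cube y))
    (Equivalence.from T-∧ (x∈A , y∈B))))

record Basis : Set₁ where
  field
    Value : Set
    Gate  : Set
    arity : Gate → ℕ
    ⟦_⟧   : (g : Gate) → Vec Value (arity g) → Value

module _ (𝓑 : Basis) where
  open Basis 𝓑

  -- A node preceded by k others, in a circuit with m input variables.
  data Node (m k : ℕ) : Set where
    input : Fin m → Node m k
    gate  : (g : Gate) → Vec (Fin k) (arity g) → Node m k

  -- Nodes are listed in a topological order.  Indices count backwards:
  -- Fin.zero refers to the most recently added node.
  data Nodes (m : ℕ) : ℕ → Set where
    []  : Nodes m 0
    _▷_ : ∀ {k} → Nodes m k → Node m k → Nodes m (suc k)

  record Circuit (m : ℕ) : Set where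
    field
      size   : ℕ
      nodes  : Nodes m size
      output : Fin size

module _ {𝓑 : Basis} where
  open Basis 𝓑

  evalNode : ∀ {m k} → Node 𝓑 m k → Vec Value m → Vec Value k → Value
  evalNode (input i)   xs vs = lookup xs i
  evalNode (gate g as) xs vs = ⟦ g ⟧ (Vec.map (lookup vs) as)

  evalNodes : ∀ {m k} → Nodes 𝓑 m k → Vec Value m → Vec Value k
  evalNodes []       xs = []
  evalNodes (ns ▷ g) xs = evalNode g xs (evalNodes ns xs) ∷ evalNodes ns xs

  eval : ∀ {m} → Circuit 𝓑 m → Vec Value m → Value
  eval C xs = lookup (evalNodes (Circuit.nodes C) xs) (Circuit.output C)

data AndOr : Set where
  and or : AndOr

boolean : Basis
boolean = record
  { Value = Bool
  ; Gate  = AndOr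
  ; arity = λ _ → 2
  ; ⟦_⟧   = λ { and (a ∷ b ∷ []) → a ∧ b ; or (a ∷ b ∷ []) → a ∨ b }
  }

-- Being non-decreasing for _≤ℝ_, the function respects _≃ℝ_.
record RealGate : Set where
  field
    arity   : ℕ
    arity≤2 : arity ℕ.≤ 2
    fun     : Vec ℝ arity → ℝ
    mono    : ∀ {xs ys} → Pointwise _≤ℝ_ xs ys → fun xs ≤ℝ fun ys

real : Basis
real = record
  { Value = ℝ
  ; Gate  = RealGate
  ; arity = RealGate.arity
  ; ⟦_⟧   = RealGate.fun
  }

MonotoneBooleanCircuit : ℕ → Set
MonotoneBooleanCircuit = Circuit boolean

MonotoneRealCircuit : ℕ → Set
MonotoneRealCircuit = Circuit real

bit : Bool → ℝ
bit false = 0ℝ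
bit true  = 1ℝ

RealSeparates : ∀ {n} → MonotoneRealCircuit n → Subset n → Subset n → Set
RealSeparates C U V =
    (∀ x → x ∈ U → eval C (Vec.map bit x) ≃ℝ 1ℝ)
  × (∀ x → x ∈ V → eval C (Vec.map bit x) ≃ℝ 0ℝ)

-- The inputs of D are x₁ … xₙ followed by y₁ … yₑ.
record CLO {n : ℕ} (U V : Subset n) : Set where
  field
    e   : ℕ
    D   : MonotoneBooleanCircuit (n ℕ.+ e)
    Uᵒ  : Fin e → Subset n
    Vᵒ  : Fin e → Subset n
    Uᵒ⊆U : ∀ j → Uᵒ j ⊆ U
    Vᵒ⊆V : ∀ j → Vᵒ j ⊆ V
    separates :
      (f : Fin e → Cube n → Bool) →
      (∀ j → Monotone (f j)) →
      (∀ j x → x ∈ Uᵒ j → f j x ≡ true) →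
      (∀ j x → x ∈ Vᵒ j → f j x ≡ false) →
        (∀ x → x ∈ U → eval D (x Vec.++ Vec.tabulate (λ j → f j x)) ≡ true)
      × (∀ x → x ∈ V → eval D (x Vec.++ Vec.tabulate (λ j → f j x)) ≡ false)

  size : ℕ
  size = Circuit.size D

  oracleUnion : PairSet n
  oracleUnion xy = any (λ j → (Uᵒ j ⊗ Vᵒ j) xy) (allFin e)

  locality : Nonempty U → Nonempty V → ℚ
  locality U≠∅ V≠∅ = (+ card oracleUnion / card (U ⊗ V)) {{card-⊗-nonZero U V U≠∅ V≠∅}}

{-# OPTIONS --safe #-}
module Submission where

import Algebra.Bundles as Bundles
import Algebra.Properties.Semiring.Exp as Exp
open import Data.Bool.Base as Bool using (Bool; true; false; T; _∧_; _∨_; b≤b; f≤t)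
open import Data.Bool.ListAction using (any)
import Data.Bool.Properties as Boolₚ
open Boolₚ using (T-∧; ∧-zeroʳ; ∨-zeroʳ)
open import Data.Empty using (⊥-elim)
open import Data.Fin.Base as Fin using (Fin; zero; suc; toℕ; fromℕ<; combine; remQuot; _↑ˡ_; _↑ʳ_)
import Data.Fin.Properties as Finₚ
open import Data.Integer.Base as ℤ using (+[1+_]) renaming (+_ to pos)
import Data.Integer.Properties as ℤₚ
open import Data.List.Base as List
  using (List; []; _∷_; length; filter; filterᵇ; allFin; cartesianProduct; cartesianProductWith)
import Data.List.Extrema as Extrema
open import Data.List.Membership.Propositional using (lose) renaming (_∈_ to _∈ˡ_)
open import Data.List.Membership.Propositional.Properties
  using (∈-filter⁺; ∈-filter⁻; ∈-map⁺; ∈-map⁻; ∈-allFin; ∈-length; ∈-cartesianProduct⁺; ∈-cartesianProductWith⁺)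
import Data.List.Properties as Listₚ
open import Data.List.Relation.Unary.All as All using (All; []; _∷_)
import Data.List.Relation.Unary.All.Properties as Allₚ
open import Data.List.Relation.Unary.Any as Any using (here; there)
open import Data.List.Relation.Unary.Any.Properties using (any⁺; any⁻; lookup-index)
open import Data.Nat
  using (ℕ; zero; suc; _+_; _*_; _^_; _/_; _%_; _⊔_; _≤_; _<_; _≤ᵇ_; _<ᵇ_; _≡ᵇ_; _<?_; z≤n; s≤s; NonZero; >-nonZero)
open import Data.Nat.DivMod
open import Data.Nat.Properties hiding (_<?_)
import Data.Nat.Solver
open import Data.Product as Product using (Σ-syntax; ∃-syntax; _×_; _,_; proj₁; proj₂)
open import Data.Rational.Base as ℚ using (ℚ; mkℚ; 0ℚ; 1ℚ; ½)
import Data.Rational.Properties as ℚₚ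
import Data.Rational.Solver
import Data.Rational.Unnormalised.Base as ℚᵘ
import Data.Rational.Unnormalised.Properties as ℚᵘₚ
open import Data.Sum using (_⊎_; inj₁; inj₂)
open import Data.Unit.Base using (⊤; tt)
open import Data.Vec.Base as Vec using (Vec; []; _∷_; lookup)
import Data.Vec.Properties as Vecₚ
open import Data.Vec.Relation.Binary.Pointwise.Inductive using (Pointwise; []; _∷_)
open import Defs
open import Function.Base using (_∘_; id; _$_)
open import Function.Bundles using (Equivalence)
open import Relation.Binary.PropositionalEquality
open import Relation.Nullary using (¬_; Dec; yes; no; does)
open import Relation.Nullary.Decidable as Dec
  using (T?; ¬?; ⌊_⌋; _×-dec_; _→-dec_; decidable-stable; ¬¬-excluded-middle; toWitness; fromWitness)

open Exp (Bundles.CommutativeRing.semiring ℚₚ.+-*-commutativeRing) using (^-assocʳ) renaming (_^_ to _^ℚ_)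

-- The pairs (u , v) with g(u) > g(v) for the output gate g can be followed down the circuit,
-- since a monotone gate with g(u) > g(v) has an argument with the same property.  Cut the values
-- of every gate into 2K + 1 blocks so that, for each u, at most |V| / K of the v ∈ V share the block of u.
-- For pairs in different blocks g(u) > g(v) is known from the blocks alone, so they are treated by
-- a Boolean function "1 on the u in block i, 0 on the v in block j < i", which is an OR of ANDs of
-- the corresponding functions of the arguments.  Pairs in the same block form an oracle rectangle.

-- Counting

-- A value shared by some u and by more than |V| / K elements of V would make u collide with all of
-- them if both sides used the same blocks. So points of U get an even label `a`, and points of V
-- get the sum `b` of the two quantiles bounding their tie class; a tie class that straddles a cut
-- then meets no label of any u. The price is a gap between order and labels: a strict label
-- inequality implies g(v) < g(u), which in turn implies only a weak label inequality. The induction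
-- therefore carries the weak inequality, and the oracle covers exactly the case of equality. The OR
-- of ANDs is the Karchmer-Wigderson translation of a round in which both sides announce the labels
-- of all arguments of a gate: the two label vectors alone determine an argument to continue with.
-- Only the order of the gate values matters, so they are replaced by natural ranks, which confines
-- the undecidability of that order to one place. With K of order 1/ε and 1 ≤ Kε, the collisions of
-- one gate have density at most ε; summing over the gates gives sε.

private variable
  A B : Set

count : (A → Bool) → List A → ℕ
count P xs = length (filterᵇ P xs)

count-mono : ∀ {P Q : A → Bool} → (∀ x → T (P x) → T (Q x)) → ∀ xs → count P xs ≤ count Q xs
count-mono P⇒Q [] = z≤n
count-mono {P = P} {Q} P⇒Q (x ∷ xs) with P x | Q x | P⇒Q x
... | true  | true  | _ = s≤s (count-mono P⇒Q xs)
... | true  | false | h = ⊥-elim (h tt)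
... | false | true  | _ = m≤n⇒m≤1+n (count-mono P⇒Q xs)
... | false | false | _ = count-mono P⇒Q xs

count-∨ : ∀ (P Q : A → Bool) xs → count (λ x → P x ∨ Q x) xs ≤ count P xs + count Q xs
count-∨ P Q [] = z≤n
count-∨ P Q (x ∷ xs) with P x | Q x
... | true  | true  = s≤s (≤-trans (count-∨ P Q xs) (+-monoʳ-≤ (count P xs) (n≤1+n _)))
... | true  | false = s≤s (count-∨ P Q xs)
... | false | true  = subst (suc (count (λ y → P y ∨ Q y) xs) ≤_)
  (sym (+-suc (count P xs) (count Q xs))) (s≤s (count-∨ P Q xs))
... | false | false = count-∨ P Q xs

count-false : ∀ (xs : List A) → count (λ _ → false) xs ≡ 0
count-false [] = refl
count-false (x ∷ xs) = count-false xs

count-disjoint : ∀ {P Q R : A → Bool} → (∀ x → T (P x) → T (R x)) → (∀ x → T (Q x) → T (R x)) →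
                 (∀ x → T (P x) → ¬ T (Q x)) → ∀ xs → count P xs + count Q xs ≤ count R xs
count-disjoint P⇒R Q⇒R dis [] = z≤n
count-disjoint {P = P} {Q} {R} P⇒R Q⇒R dis (x ∷ xs) with P x | Q x | R x | P⇒R x | Q⇒R x | dis x
... | true  | true  | _     | _ | _ | d = ⊥-elim (d tt tt)
... | true  | false | true  | _ | _ | _ = s≤s (count-disjoint P⇒R Q⇒R dis xs)
... | true  | false | false | h | _ | _ = ⊥-elim (h tt)
... | false | true  | true  | _ | _ | _ =
  subst (_≤ suc (count R xs)) (sym (+-suc (count P xs) _)) (s≤s (count-disjoint P⇒R Q⇒R dis xs))
... | false | true  | false | _ | h | _ = ⊥-elim (h tt)
... | false | false | true  | _ | _ | _ = m≤n⇒m≤1+n (count-disjoint P⇒R Q⇒R dis xs)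
... | false | false | false | _ | _ | _ = count-disjoint P⇒R Q⇒R dis xs

-- Union bound, multiplied through by `K` so that no counts are divided.
count-any : ∀ (P : B → A → Bool) (gs : List B) xs K m → (∀ g → K * count (P g) xs ≤ m) →
            K * count (λ x → any (λ g → P g x) gs) xs ≤ length gs * m
count-any P [] xs K m h = ≤-reflexive (trans (cong (K *_) (count-false xs)) (*-zeroʳ K))
count-any P (g ∷ gs) xs K m h = begin
  K * count (λ x → P g x ∨ any (λ g′ → P g′ x) gs) xs ≤⟨ *-monoʳ-≤ K (count-∨ (P g) _ xs) ⟩
  K * (count (P g) xs + count (λ x → any (λ g′ → P g′ x) gs) xs) ≡⟨ *-distribˡ-+ K (count (P g) xs) _ ⟩
  K * count (P g) xs + K * count (λ x → any (λ g′ → P g′ x) gs) xs ≤⟨ +-mono-≤ (h g) (count-any P gs xs K m h) ⟩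
  m + length gs * m ∎
  where open ≤-Reasoning

count-++ : ∀ (P : A → Bool) xs ys → count P (xs List.++ ys) ≡ count P xs + count P ys
count-++ P xs ys = trans (cong length (Listₚ.filter-++ (T? ∘ P) xs ys)) (Listₚ.length-++ (filterᵇ P xs))

count-map : ∀ (P : B → Bool) (f : A → B) xs → count P (List.map f xs) ≡ count (P ∘ f) xs
count-map P f [] = refl
count-map P f (x ∷ xs) with P (f x)
... | true  = cong suc (count-map P f xs)
... | false = count-map P f xs

-- Summation over rows: a density estimate on pairs needs only an estimate on each fibre over a
-- fixed first component.
count-cartesianProduct : ∀ (P Q : A × B → Bool) K s (xs : List A) (ys : List B) →
  (∀ x → K * count (λ y → P (x , y)) ys ≤ s * count (λ y → Q (x , y)) ys) →
  K * count P (cartesianProduct xs ys) ≤ s * count Q (cartesianProduct xs ys)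
count-cartesianProduct P Q K s [] ys h = ≤-reflexive (trans (*-zeroʳ K) (sym (*-zeroʳ s)))
count-cartesianProduct P Q K s (x ∷ xs) ys h = begin
  K * count P (row List.++ rest)                    ≡⟨ split P K ⟩
  K * count (λ y → P (x , y)) ys + K * count P rest ≤⟨ +-mono-≤ (h x) (count-cartesianProduct P Q K s xs ys h) ⟩
  s * count (λ y → Q (x , y)) ys + s * count Q rest ≡⟨ split Q s ⟨
  s * count Q (row List.++ rest)                    ∎
  where
  open ≤-Reasoning
  row = List.map (x ,_) ys
  rest = cartesianProduct xs ys
  split : ∀ R k → k * count R (row List.++ rest) ≡ k * count (λ y → R (x , y)) ys + k * count R rest
  split R k = trans (cong (k *_) (trans (count-++ R row rest) (cong (_+ count R rest) (count-map R (x ,_) ys))))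
                    (*-distribˡ-+ k (count (λ y → R (x , y)) ys) (count R rest))

-- Quantiles

-- Needed for collisions: the label `b` is a sum of two quantiles, and its equality with an even
-- label must force each of them to be half of it.
average-above⇒≡ : ∀ {a b c} → a ≤ b → b ≤ c → a + b ≡ 2 * c → a ≡ c × b ≡ c
average-above⇒≡ {a} {b} {c} a≤b b≤c eq = a≡c , ≤-antisym b≤c (subst (_≤ b) a≡c a≤b)
  where
  a≡c : a ≡ c
  a≡c = ≤-antisym (≤-trans a≤b b≤c) (+-cancelʳ-≤ c c a (begin
    c + c       ≡⟨ cong (c +_) (+-identityʳ c) ⟨
    2 * c       ≡⟨ eq ⟨
    a + b       ≤⟨ +-monoʳ-≤ a b≤c ⟩
    a + c       ∎))
    where open ≤-Reasoning

average-below⇒≡ : ∀ {a b c} → c ≤ a → a ≤ b → a + b ≡ 2 * c → a ≡ c × b ≡ c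
average-below⇒≡ {a} {b} {c} c≤a a≤b eq = ≤-antisym (subst (a ≤_) b≡c a≤b) c≤a , b≡c
  where
  b≡c : b ≡ c
  b≡c = ≤-antisym (+-cancelˡ-≤ c b c (begin
    c + b       ≤⟨ +-monoˡ-≤ b c≤a ⟩
    a + b       ≡⟨ eq ⟩
    2 * c       ≡⟨ cong (c +_) (+-identityʳ c) ⟩
    c + c       ∎)) (≤-trans c≤a a≤b)
    where open ≤-Reasoning

module Quantiles {A : Set} (xs : List A) (complete : ∀ x → x ∈ˡ xs) (V : A → Bool) (r : A → ℕ) (K : ℕ)
                 {{_ : NonZero (count V xs)}} where
  private
    m = count V xs

  below upto : ℕ → ℕ
  below t = count (λ v → V v ∧ (r v <ᵇ t)) xs
  upto  t = count (λ v → V v ∧ (r v ≤ᵇ t)) xs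

  -- Integer quantile: about m / K successive positions share a value.
  f : ℕ → ℕ
  f c = c * K / m

  f-mono : ∀ {c d} → c ≤ d → f c ≤ f d
  f-mono c≤d = /-monoˡ-≤ m (*-monoˡ-≤ K c≤d)

  f≤K : ∀ {c} → c ≤ m → f c ≤ K
  f≤K c≤m = ≤-trans (f-mono c≤m) (≤-reflexive (trans (/-congˡ (*-comm m K)) (m*n/n≡m K m)))

  -- Doubling makes the label of a u comparable with the sum of the two end quantiles of a tie
  -- class. When those ends differ, `b v` lies strictly between their doubles, where no `a u` falls.
  a b : A → ℕ
  a u = 2 * f (below (r u))
  b v = f (below (r v)) + f (upto (r v))

  private
    ∧-split : ∀ {x y} → T (x ∧ y) → T x × T y
    ∧-split = Equivalence.to T-∧
    ∧-pair : ∀ {x y} → T x × T y → T (x ∧ y)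
    ∧-pair = Equivalence.from T-∧

    <⇒upto≤below : ∀ {i j} → i < j → upto i ≤ below j
    <⇒upto≤below i<j = count-mono (λ v h → let p , q = ∧-split h in
      ∧-pair (p , <⇒<ᵇ (≤-<-trans (≤ᵇ⇒≤ _ _ q) i<j))) xs
    below-mono : ∀ {i j} → i ≤ j → below i ≤ below j
    below-mono i≤j = count-mono (λ v h → let p , q = ∧-split h in
      ∧-pair (p , <⇒<ᵇ (<-≤-trans (<ᵇ⇒< _ _ q) i≤j))) xs
    below≤upto : ∀ i → below i ≤ upto i
    below≤upto i = count-mono (λ v h → let p , q = ∧-split h in
      ∧-pair (p , ≤⇒≤ᵇ (<⇒≤ (<ᵇ⇒< (r v) i q)))) xs
    below≤m : ∀ i → below i ≤ m
    below≤m i = count-mono (λ v → proj₁ ∘ ∧-split) xs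
    upto≤m : ∀ i → upto i ≤ m
    upto≤m i = count-mono (λ v → proj₁ ∘ ∧-split) xs
    2x : ∀ x → x + x ≡ 2 * x
    2x x = cong (x +_) (sym (+-identityʳ x))

  r<⇒b≤a : ∀ u v → r v < r u → b v ≤ a u
  r<⇒b≤a u v h = subst (b v ≤_) (2x (f (below (r u))))
    (+-mono-≤ (f-mono (below-mono (<⇒≤ h))) (f-mono (<⇒upto≤below h)))

  r≤⇒a≤b : ∀ u v → r u ≤ r v → a u ≤ b v
  r≤⇒a≤b u v h = subst (_≤ b v) (2x (f (below (r u))))
    (+-mono-≤ (f-mono (below-mono h)) (f-mono (≤-trans (below-mono h) (below≤upto (r v)))))

  a< : ∀ u → a u < suc (2 * K)
  a< u = s≤s (*-monoʳ-≤ 2 (f≤K (below≤m (r u))))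

  b< : ∀ v → b v < suc (2 * K)
  b< v = s≤s (subst (b v ≤_) (2x K) (+-mono-≤ (f≤K (below≤m (r v))) (f≤K (upto≤m (r v)))))

  -- If u ranks above v, its position is past the tie class of v, so `a u` is at least twice either
  -- end quantile; otherwise it is at most twice either. Equality with their sum leaves no slack.
  collision : ∀ u v → a u ≡ b v → let q = f (below (r u)) in f (below (r v)) ≡ q × f (upto (r v)) ≡ q
  collision u v eq with <-≤-connex (r v) (r u)
  ... | inj₁ h = average-above⇒≡ (f-mono (below≤upto (r v))) (f-mono (<⇒upto≤below h)) (sym eq)
  ... | inj₂ h = average-below⇒≡ (f-mono (below-mono h)) (f-mono (below≤upto (r v))) (sym eq)

  -- An arithmetic progression of c steps of length K / m that crosses no integer has c ≤ m / K.
  short : ∀ c d e → c + d ≤ e → f d ≡ f e → K * c ≤ m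
  short c d e c+d≤e eq = +-cancelʳ-≤ (d * K) (K * c) m (begin
    K * c + d * K             ≡⟨ cong (_+ d * K) (*-comm K c) ⟩
    c * K + d * K             ≡⟨ *-distribʳ-+ K c d ⟨
    (c + d) * K               ≤⟨ *-monoˡ-≤ K c+d≤e ⟩
    e * K                     ≡⟨ m≡m%n+[m/n]*n (e * K) m ⟩
    e * K % m + f e * m       ≤⟨ +-mono-≤ (m%n≤n (e * K) m) (≤-reflexive (cong (_* m) (sym eq))) ⟩
    m + f d * m               ≤⟨ +-monoʳ-≤ m (m/n*n≤m (d * K) m) ⟩
    m + d * K                 ∎)
    where open ≤-Reasoning

  -- All colliding v rank between the extreme ones `lo` and `hi`, and the quantile takes the same
  -- value just below `lo` and at the end of the tie class of `hi`. Such a stretch is bounded by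
  -- `short`.
  few-collisions : ∀ u → K * count (λ v → V v ∧ (a u ≡ᵇ b v)) xs ≤ m
  few-collisions u with filterᵇ P xs in eq
    where P = λ v → V v ∧ (a u ≡ᵇ b v)
  ... | [] = ≤-trans (≤-reflexive (*-zeroʳ K)) z≤n
  ... | y ∷ ys = subst (λ l → K * length l ≤ m) eq
      (short (count P xs) (below (r lo)) (upto (r hi)) separated
        (trans (proj₁ (coll lo lo∈)) (sym (proj₂ (coll hi hi∈)))))
    where
    open Extrema ≤-totalOrder
    P : A → Bool
    P v = V v ∧ (a u ≡ᵇ b v)
    lo hi : A
    lo = argmin r y ys
    hi = argmax r y ys
    lo∈ : lo ∈ˡ (y ∷ ys)
    lo∈ with argmin-sel r y ys
    ... | inj₁ e = here e
    ... | inj₂ e = there e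
    hi∈ : hi ∈ˡ (y ∷ ys)
    hi∈ with argmax-sel r y ys
    ... | inj₁ e = here e
    ... | inj₂ e = there e
    extremal : ∀ {z} → z ∈ˡ (y ∷ ys) → r lo ≤ r z × r z ≤ r hi
    extremal (here refl) = f[argmin]≤f[⊤] {f = r} y ys , f[⊥]≤f[argmax] {f = r} y ys
    extremal (there z∈) = All.lookup (f[argmin]≤f[xs] {f = r} y ys) z∈ , All.lookup (f[xs]≤f[argmax] {f = r} y ys) z∈
    ∈⇒P : ∀ {z} → z ∈ˡ (y ∷ ys) → z ∈ˡ xs × T (P z)
    ∈⇒P z∈ = ∈-filter⁻ (T? ∘ P) {xs = xs} (subst (_ ∈ˡ_) (sym eq) z∈)
    P⇒∈ : ∀ z → T (P z) → z ∈ˡ (y ∷ ys)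
    P⇒∈ z h = subst (z ∈ˡ_) eq (∈-filter⁺ (T? ∘ P) (complete z) h)
    coll : ∀ z → z ∈ˡ (y ∷ ys) → f (below (r z)) ≡ f (below (r u)) × f (upto (r z)) ≡ f (below (r u))
    coll z z∈ = collision u z (≡ᵇ⇒≡ _ _ (proj₂ (∧-split (proj₂ (∈⇒P z∈)))))
    separated : count P xs + below (r lo) ≤ upto (r hi)
    separated = count-disjoint {P = P} {λ v → V v ∧ (r v <ᵇ r lo)} {λ v → V v ∧ (r v ≤ᵇ r hi)}
      (λ v h → ∧-pair (proj₁ (∧-split h) , ≤⇒≤ᵇ (proj₂ (extremal (P⇒∈ v h)))))
      (λ v h → let p , q = ∧-split h in
        ∧-pair (p , ≤⇒≤ᵇ (≤-trans (<⇒≤ (<ᵇ⇒< (r v) (r lo) q)) (proj₁ (extremal hi∈)))))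
      (λ v h h′ → <⇒≱ (<ᵇ⇒< (r v) (r lo) (proj₂ (∧-split h′))) (proj₁ (extremal (P⇒∈ v h))))
      xs

-- Boolean circuits

∃-cube? : ∀ {n} {P : Cube n → Set} → (∀ x → Dec (P x)) → Dec (∃[ x ] P x)
∃-cube? {n} {P} P? with Any.any? P? (cube n)
... | yes h = yes (Any.satisfied h)
... | no ¬h = no λ { (x , px) → ¬h (Any.map (λ { refl → px }) (∈-cube x)) }

allVecs : ∀ q a → List (Vec (Fin q) a)
allVecs q zero    = [] ∷ []
allVecs q (suc a) = cartesianProductWith _∷_ (allFin q) (allVecs q a)

∈-allVecs : ∀ {q a} (p : Vec (Fin q) a) → p ∈ˡ allVecs q a
∈-allVecs []      = here refl
∈-allVecs (i ∷ p) = ∈-cartesianProductWith⁺ _∷_ (∈-allFin i) (∈-allVecs p)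

length-cartesianProductWith : ∀ {C : Set} (f : A → B → C) xs ys →
  length (cartesianProductWith f xs ys) ≡ length xs * length ys
length-cartesianProductWith f [] ys = refl
length-cartesianProductWith f (x ∷ xs) ys = trans (Listₚ.length-++ (List.map (f x) ys))
  (cong₂ _+_ (Listₚ.length-map (f x) ys) (length-cartesianProductWith f xs ys))

length-allFin : ∀ q → length (allFin q) ≡ q
length-allFin q = Listₚ.length-tabulate id

length-allVecs : ∀ q a → length (allVecs q a) ≡ q ^ a
length-allVecs q zero    = refl
length-allVecs q (suc a) = trans (length-cartesianProductWith _∷_ (allFin q) (allVecs q a))
  (cong₂ _*_ (length-allFin q) (length-allVecs q a))

Fun : ℕ → Set
Fun m = Vec Bool m → Bool

module _ {m : ℕ} where

  BNodes : ℕ → Set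
  BNodes = Nodes boolean m

  record Has {k} (N : BNodes k) (h : Fun m) : Set where
    constructor _,_
    field
      wire      : Fin k
      evaluates : ∀ xs → lookup (evalNodes N xs) wire ≡ h xs

  -- Inclusion is expressed through the functions computed, because each appended node shifts the
  -- indices of all older ones.
  _⊑_ : ∀ {k l} → BNodes k → BNodes l → Set
  N ⊑ N′ = ∀ {h} → Has N h → Has N′ h

  -- A growing circuit with a budget `b` for added nodes, in which everything computed before
  -- remains available. Budgets add up in `extend-trans`.
  record Extension {k} (N : BNodes k) (b : ℕ) (P : ∀ {l} → BNodes l → Set) : Set where
    constructor extension
    field
      {size}   : ℕ
      nodes    : BNodes size
      size≤    : size ≤ b + k
      includes : N ⊑ nodes
      property : P nodes

  add-node : ∀ {k} (N : BNodes k) nd → N ⊑ (N ▷ nd)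
  add-node N nd (w , eq) = suc w , eq

  _⊕_ : AndOr → Fun m → Fun m → Fun m
  (and ⊕ f) g xs = f xs ∧ g xs
  (or ⊕ f) g xs = f xs ∨ g xs

  extend-input : ∀ {k} (N : BNodes k) i → Extension N 1 (λ N′ → Has N′ (λ xs → lookup xs i))
  extend-input N i = extension (N ▷ input i) ≤-refl (add-node N (input i)) (zero , λ _ → refl)

  extend-op : ∀ {k} (N : BNodes k) o {f g} → Has N f → Has N g → Extension N 1 (λ N′ → Has N′ ((o ⊕ f) g))
  extend-op N o (v , p) (w , q) =
    extension (N ▷ gate o (v ∷ w ∷ [])) ≤-refl (add-node N (gate o (v ∷ w ∷ []))) (zero , evaluates o)
    where
    evaluates : ∀ o xs → lookup (evalNodes (N ▷ gate o (v ∷ w ∷ [])) xs) zero ≡ (o ⊕ _) _ xs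
    evaluates and xs = cong₂ _∧_ (p xs) (q xs)
    evaluates or  xs = cong₂ _∨_ (p xs) (q xs)

  extend-trans : ∀ {k} {N : BNodes k} {b c} {P Q : ∀ {l} → BNodes l → Set} → Extension N b P →
    (∀ {l} (N′ : BNodes l) → N ⊑ N′ → P N′ → Extension N′ c Q) → Extension N (c + b) Q
  extend-trans {k} {b = b} {c} (extension N′ l≤ inc p) step with step N′ inc p
  ... | extension N″ l′≤ inc′ q = extension N″
    (≤-trans l′≤ (≤-trans (+-monoʳ-≤ c l≤) (≤-reflexive (sym (+-assoc c b k))))) (inc′ ∘ inc) q

  extend-weaken : ∀ {k} {N : BNodes k} {b c} {P Q : ∀ {l} → BNodes l → Set} → b ≤ c →
    (∀ {l} (N′ : BNodes l) → N ⊑ N′ → P N′ → Q N′) → Extension N b P → Extension N c Q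
  extend-weaken {k} b≤c f (extension N′ l≤ inc p) = extension N′ (≤-trans l≤ (+-monoˡ-≤ k b≤c)) inc (f N′ inc p)

  extend-all : ∀ {k} (N : BNodes k) b (t : A → Fun m) (xs : List A) →
    (∀ {l} (N′ : BNodes l) → N ⊑ N′ → ∀ a → Extension N′ b (λ N″ → Has N″ (t a))) →
    Extension N (length xs * b) (λ N′ → ∀ a → a ∈ˡ xs → Has N′ (t a))
  extend-all {k = k} N b t [] step = extension N ≤-refl id λ _ ()
  extend-all N b t (x ∷ xs) step = extend-trans (extend-all N b t xs step) λ N′ inc old →
    extend-weaken ≤-refl (λ N″ inc′ new a → λ { (here refl) → new ; (there a∈) → inc′ (old a a∈) })
      (step N′ inc x)

  -- Bases without constants: an empty combination takes the arbitrary value d.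
  fold⊕ : AndOr → Fun m → List (Fun m) → Fun m
  fold⊕ o d []       = d
  fold⊕ o d (f ∷ fs) = List.foldr (o ⊕_) f fs

  extend-fold : ∀ {k} (N : BNodes k) o {d} fs → Has N d → All (Has N) fs →
    Extension N (length fs) (λ N′ → Has N′ (fold⊕ o d fs))
  extend-fold {k} N o [] hd hs = extension N ≤-refl id hd
  extend-fold {k} N o (f ∷ fs) hd (hf ∷ hs) = extend-weaken (n≤1+n _) (λ _ _ → id) (go fs hs)
    where
    go : ∀ gs → All (Has N) gs → Extension N (length gs) (λ N′ → Has N′ (List.foldr (o ⊕_) f gs))
    go [] [] = extension N ≤-refl id hf
    go (g ∷ gs) (hg ∷ hgs) = extend-trans (go gs hgs) λ N′ inc h → extend-op N′ o (inc hg) h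

  unit zeroᵒ : AndOr → Bool
  unit and = true
  unit or = false
  zeroᵒ and = false
  zeroᵒ or = true

  fold-unit : ∀ o d fs xs {f} → f ∈ˡ fs → (∀ g → g ∈ˡ fs → g xs ≡ unit o) → fold⊕ o d fs xs ≡ unit o
  fold-unit o d (f ∷ fs) xs _ h = go fs (h f (here refl)) (λ g → h g ∘ there)
    where
    ⊕-unit : ∀ o f g → f xs ≡ unit o → g xs ≡ unit o → (o ⊕ f) g xs ≡ unit o
    ⊕-unit and f g p q = cong₂ _∧_ p q
    ⊕-unit or  f g p q = cong₂ _∨_ p q
    go : ∀ {f} fs → f xs ≡ unit o → (∀ g → g ∈ˡ fs → g xs ≡ unit o) → List.foldr (o ⊕_) f fs xs ≡ unit o
    go [] p _ = p
    go (g ∷ gs) p h = ⊕-unit o g _ (h g (here refl)) (go gs p (λ g′ → h g′ ∘ there))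

  fold-zero : ∀ o d fs xs {f} → f ∈ˡ fs → f xs ≡ zeroᵒ o → fold⊕ o d fs xs ≡ zeroᵒ o
  fold-zero o d (f₀ ∷ fs) xs f∈ eq = go fs f∈
    where
    ⊕-zeroˡ : ∀ o f g → f xs ≡ zeroᵒ o → (o ⊕ f) g xs ≡ zeroᵒ o
    ⊕-zeroˡ and f g p = cong (_∧ g xs) p
    ⊕-zeroˡ or  f g p = cong (_∨ g xs) p
    ⊕-zeroʳ : ∀ o f g → g xs ≡ zeroᵒ o → (o ⊕ f) g xs ≡ zeroᵒ o
    ⊕-zeroʳ and f g p = trans (cong (f xs ∧_) p) (∧-zeroʳ (f xs))
    ⊕-zeroʳ or  f g p = trans (cong (f xs ∨_) p) (∨-zeroʳ (f xs))
    go : ∀ gs → _ ∈ˡ (f₀ ∷ gs) → List.foldr (o ⊕_) f₀ gs xs ≡ zeroᵒ o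
    go [] (here refl) = eq
    go (g ∷ gs) (here refl) = ⊕-zeroʳ o g _ (go gs (here refl))
    go (g ∷ gs) (there (here refl)) = ⊕-zeroˡ o g (List.foldr (o ⊕_) f₀ gs) eq
    go (g ∷ gs) (there (there f∈)) = ⊕-zeroʳ o g _ (go gs (there f∈))

  orAnd : Fun m → List A → List B → (A → B → Fun m) → Fun m
  orAnd d as bs h = fold⊕ or d (List.map (λ a → fold⊕ and d (List.map (h a) bs)) as)

  extend-orAnd : ∀ {k} (N : BNodes k) {d} (as : List A) (bs : List B) h → Has N d → (∀ a b → Has N (h a b)) →
    Extension N (length as + length as * length bs) (λ N′ → Has N′ (orAnd d as bs h))
  extend-orAnd N {d} as bs h hd hh = extend-trans
    (extend-all N (length bs) conj as λ N′ inc a →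
      extend-weaken (≤-reflexive (Listₚ.length-map (h a) bs)) (λ _ _ → id)
        (extend-fold N′ and (List.map (h a) bs) (inc hd) (Allₚ.map⁺ (All.universal (λ b → inc (hh a b)) bs))))
    λ N′ inc hc → extend-weaken (≤-reflexive (Listₚ.length-map conj as)) (λ _ _ → id)
      (extend-fold N′ or (List.map conj as) (inc hd) (Allₚ.map⁺ (All.tabulate (λ {a} → hc a))))
    where
    conj : _ → Fun m
    conj a = fold⊕ and d (List.map (h a) bs)

  -- The memberships assumed here and in `orAnd-false` exclude empty combinations, whose value `d`
  -- is arbitrary.
  orAnd-true : ∀ d (as : List A) (bs : List B) h xs {a b} → a ∈ˡ as → b ∈ˡ bs →
    (∀ b → b ∈ˡ bs → h a b xs ≡ true) → orAnd d as bs h xs ≡ true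
  orAnd-true d as bs h xs {a} a∈ b∈ eq = fold-zero or d _ xs (∈-map⁺ _ a∈)
    (fold-unit and d _ xs (∈-map⁺ (h a) b∈) λ g g∈ → let b , b∈ , g≡ = ∈-map⁻ (h a) g∈ in
      trans (cong (_$ xs) g≡) (eq b b∈))

  orAnd-false : ∀ d (as : List A) (bs : List B) h xs {a} → a ∈ˡ as →
    (∀ a → a ∈ˡ as → ∃[ b ] (b ∈ˡ bs × h a b xs ≡ false)) → orAnd d as bs h xs ≡ false
  orAnd-false d as bs h xs a∈ eq = fold-unit or d _ xs (∈-map⁺ _ a∈) λ g g∈ →
    let a , a∈ , g≡ = ∈-map⁻ _ g∈ ; b , b∈ , e = eq a a∈ in
    trans (cong (_$ xs) g≡) (fold-zero and d _ xs (∈-map⁺ (h a) b∈) e)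

-- From label protocols to Boolean functions and circuits

module Protocol {n : ℕ} (U V : Subset n) (q : ℕ) where

  Label : ℕ → Set
  Label k = Fin k → Cube n → Fin q

  -- A strict inequality at a gate need only give a weak one at an argument, since passing from
  -- values to blocks may identify u and v there; that case is left to the oracle of the argument.
  NodeSound : ∀ {k} → Node real n k → Label (suc k) → Label (suc k) → Set
  NodeSound (input p) α β = ∀ u v → u ∈ U → v ∈ V → β zero v Fin.< α zero u →
    lookup u p ≡ true × lookup v p ≡ false
  NodeSound (gate g as) α β = ∀ u v → u ∈ U → v ∈ V → β zero v Fin.< α zero u →
    ∃[ c ] (β (suc (lookup as c)) v Fin.≤ α (suc (lookup as c)) u)

  Sound : ∀ {k} → Nodes real n k → Label k → Label k → Set
  Sound []        α β = ⊤
  Sound (ns ▷ nd) α β = NodeSound nd α β × Sound ns (α ∘ suc) (β ∘ suc)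

  module Circuits {m : ℕ} (In : Fin n → Fun m) (d : Fun m) where

    -- `E` completes a point by the oracle answers. The oracle for gate `c` and block `i` is
    -- required to be right only on the points of that block.
    record Faithful {k} (α β : Label k) (O : Fin k → Fin q → Fun m) (E : Cube n → Vec Bool m) : Set where
      field
        inputs  : ∀ x p → In p (E x) ≡ lookup x p
        oracleU : ∀ c u → u ∈ U → O c (α c u) (E u) ≡ true
        oracleV : ∀ c v → v ∈ V → O c (β c v) (E v) ≡ false

    Family : ℕ → Set
    Family k = Fin k → Fin q → Fin q → Fun m

    Correct : ∀ {k} → Label k → Label k → (Cube n → Vec Bool m) → Family k → Set
    Correct α β E W = ∀ c u v → u ∈ U → v ∈ V → β c v Fin.≤ α c u →
      W c (α c u) (β c v) (E u) ≡ true × W c (α c u) (β c v) (E v) ≡ false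

    module Combine {k a} (α β : Label k) (as : Vec (Fin k) a) (W : Family k) where

      profile : Label k → Cube n → Vec (Fin q) a
      profile γ x = Vec.map (λ c → γ c x) as

      realised : Label k → (S : Subset n) → List (Vec (Fin q) a)
      realised γ S = filter (λ p → ∃-cube? (λ x → T? (S x) ×-dec Vecₚ.≡-dec Finₚ._≟_ (profile γ x) p)) (allVecs q a)

      ∈-realised : ∀ γ S x → x ∈ S → profile γ x ∈ˡ realised γ S
      ∈-realised γ S x x∈ = ∈-filter⁺ _ (∈-allVecs (profile γ x)) (x , x∈ , refl)

      realised-∈ : ∀ γ S {p} → p ∈ˡ realised γ S → ∃[ x ] (x ∈ S × profile γ x ≡ p)
      realised-∈ γ S p∈ = proj₂ (∈-filter⁻ _ {xs = allVecs q a} p∈)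

      pick : Vec (Fin q) a → Vec (Fin q) a → Fun m
      pick p p′ with Finₚ.any? (λ c → lookup p′ c Finₚ.≤? lookup p c)
      ... | yes (c , _) = W (lookup as c) (lookup p c) (lookup p′ c)
      ... | no _        = d

      combined : Subset n → Subset n → Fun m
      combined S S′ = orAnd d (realised α S) (realised β S′) pick

      has-pick : ∀ {l} {N : BNodes l} → Has N d → (∀ c i j → Has N (W c i j)) → ∀ p p′ → Has N (pick p p′)
      has-pick hd hW p p′ with Finₚ.any? (λ c → lookup p′ c Finₚ.≤? lookup p c)
      ... | yes (c , _) = hW _ _ _
      ... | no _        = hd

      extend-combined : ∀ {l} (N : BNodes l) → 1 ≤ q → a ≤ 2 → Has N d → (∀ c i j → Has N (W c i j)) → ∀ S S′ →
        Extension N (q ^ 2 + q ^ 2 * q ^ 2) (λ N′ → Has N′ (combined S S′))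
      extend-combined N 1≤q a≤2 hd hW S S′ = extend-weaken
        (+-mono-≤ (few α S) (*-mono-≤ (few α S) (few β S′))) (λ _ _ → id)
        (extend-orAnd N (realised α S) (realised β S′) pick hd (has-pick hd hW))
        where
        few : ∀ γ S → length (realised γ S) ≤ q ^ 2
        few γ S = ≤-trans (Listₚ.length-filter _ (allVecs q a))
          (≤-trans (≤-reflexive (length-allVecs q a)) (^-monoʳ-≤ q {{>-nonZero 1≤q}} a≤2))

      module _ {S S′ : Subset n} (S⊆U : S ⊆ U) (S′⊆V : S′ ⊆ V)
               (branch : ∀ u v → u ∈ S → v ∈ S′ → ∃[ c ] (β (lookup as c) v Fin.≤ α (lookup as c) u))
               {E} (correct : Correct α β E W) where

        pick-correct : ∀ u v → u ∈ S → v ∈ S′ →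
          pick (profile α u) (profile β v) (E u) ≡ true × pick (profile α u) (profile β v) (E v) ≡ false
        pick-correct u v u∈ v∈ with Finₚ.any? (λ c → lookup (profile β v) c Finₚ.≤? lookup (profile α u) c)
        ... | yes (c , le)
          rewrite Vecₚ.lookup-map c (λ c → α c u) as | Vecₚ.lookup-map c (λ c → β c v) as
          = correct (lookup as c) u v (S⊆U u u∈) (S′⊆V v v∈) le
        ... | no none = ⊥-elim (none (let c , le = branch u v u∈ v∈ in c , subst₂ Fin._≤_
                (sym (Vecₚ.lookup-map c (λ c → β c v) as)) (sym (Vecₚ.lookup-map c (λ c → α c u) as)) le))

        -- At u the disjunct of its own profile is true: every conjunct stems from some actual v′,
        -- and correctness for u and v′ gives its value at u. Dually, at v every disjunct stems from
        -- some u′ and is false through the conjunct of the profile of v.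
        combined-correct : ∀ u v → u ∈ S → v ∈ S′ → combined S S′ (E u) ≡ true × combined S S′ (E v) ≡ false
        combined-correct u v u∈ v∈ =
          orAnd-true d _ _ pick (E u) (∈-realised α S u u∈) (∈-realised β S′ v v∈)
            (λ p′ p′∈ → let v′ , v′∈ , e = realised-∈ β S′ p′∈ in
              subst (λ p → pick (profile α u) p (E u) ≡ true) e (proj₁ (pick-correct u v′ u∈ v′∈))) ,
          orAnd-false d _ _ pick (E v) (∈-realised α S u u∈)
            (λ p p∈ → let u′ , u′∈ , e = realised-∈ α S p∈ in profile β v , ∈-realised β S′ v v∈ ,
              subst (λ p → pick p (profile β v) (E v) ≡ false) e (proj₂ (pick-correct u′ v u′∈ v∈)))

    class : (S : Subset n) → (Cube n → Fin q) → Fin q → Subset n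
    class S γ i x = S x ∧ does (γ x Finₚ.≟ i)

    class⇒ : ∀ S γ i {x} → x ∈ class S γ i → x ∈ S × γ x ≡ i
    class⇒ S γ i {x} h with S x | γ x Finₚ.≟ i
    ... | true | yes e = tt , e

    ⇒class : ∀ S γ {x} → x ∈ S → x ∈ class S γ (γ x)
    ⇒class S γ {x} h with S x | γ x Finₚ.≟ γ x
    ... | true | yes e = tt
    ... | true | no ne = ne refl

    node : ∀ {k} → Node real n k → Label (suc k) → Label (suc k) → Family k → Fin q → Fin q → Fun m
    node (input p)   α β W i j = In p
    node (gate g as) α β W i j = Combine.combined (α ∘ suc) (β ∘ suc) as W
                                   (class U (α zero) i) (class V (β zero) j)

    nodeOrOracle : ∀ {k} → Node real n k → Label (suc k) → Label (suc k) → (Fin q → Fun m) → Family k →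
                   Fin q → Fin q → Fun m
    nodeOrOracle nd α β O W i j with i Finₚ.≟ j
    ... | yes _ = O i
    ... | no _  = node nd α β W i j

    family : ∀ {k} → Nodes real n k → Label k → Label k → (Fin k → Fin q → Fun m) → Family k
    family (ns ▷ nd) α β O zero    = nodeOrOracle nd α β (O zero) (family ns (α ∘ suc) (β ∘ suc) (O ∘ suc))
    family (ns ▷ nd) α β O (suc c) = family ns (α ∘ suc) (β ∘ suc) (O ∘ suc) c

    -- Induction along the circuit. Equal blocks are settled by the oracle; distinct ones make the
    -- label inequality strict, which `Sound` passes to an argument.
    family-correct : ∀ {k} (ns : Nodes real n k) α β O E → Sound ns α β → Faithful α β O E →
                     Correct α β E (family ns α β O)
    family-correct (ns ▷ nd) α β O E (snd , sound) faithful (suc c) =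
      family-correct ns _ _ _ E sound (record { inputs = inputs ; oracleU = oracleU ∘ suc ; oracleV = oracleV ∘ suc }) c
      where open Faithful faithful
    family-correct (ns ▷ nd) α β O E (snd , sound) faithful zero u v u∈ v∈ le with α zero u Finₚ.≟ β zero v
    ... | yes e = oracleU zero u u∈ , trans (cong (λ i → O zero i (E v)) e) (oracleV zero v v∈)
      where open Faithful faithful
    ... | no ne = go nd snd
      where
      open Faithful faithful
      lt : β zero v Fin.< α zero u
      lt = ≤∧≢⇒< le (ne ∘ sym ∘ Finₚ.toℕ-injective)
      W = family ns (α ∘ suc) (β ∘ suc) (O ∘ suc)
      go : ∀ nd → NodeSound nd α β →
           node nd α β W (α zero u) (β zero v) (E u) ≡ true × node nd α β W (α zero u) (β zero v) (E v) ≡ false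
      go (input p) snd = let eu , ev = snd u v u∈ v∈ lt in trans (inputs u p) eu , trans (inputs v p) ev
      go (gate g as) snd = Combine.combined-correct (α ∘ suc) (β ∘ suc) as W
        (λ x → proj₁ ∘ class⇒ U (α zero) _) (λ x → proj₁ ∘ class⇒ V (β zero) _)
        (λ u′ v′ u′∈ v′∈ → let u′∈U , eu = class⇒ U (α zero) _ u′∈ ; v′∈V , ev = class⇒ V (β zero) _ v′∈ in
          snd u′ v′ u′∈U v′∈V (subst₂ Fin._<_ (sym ev) (sym eu) lt))
        (family-correct ns _ _ _ E sound (record { inputs = inputs ; oracleU = oracleU ∘ suc ; oracleV = oracleV ∘ suc }))
        u v (⇒class U (α zero) u∈) (⇒class V (β zero) v∈)

    -- One function per pair of blocks. With at most two arguments there are at most q² profiles on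
    -- each side, hence q² conjunctions of q² terms and one disjunction of q² terms.
    stageCost : ℕ
    stageCost = q * q * (q ^ 2 + q ^ 2 * q ^ 2)

    extend-family : ∀ {k l} (ns : Nodes real n k) α β O (N : BNodes l) → 1 ≤ q →
      Has N d → (∀ p → Has N (In p)) → (∀ c i → Has N (O c i)) →
      Extension N (k * stageCost) (λ N′ → ∀ c i j → Has N′ (family ns α β O c i j))
    extend-family {l = l} [] α β O N 1≤q hd hI hO = extension N ≤-refl id λ ()
    extend-family (ns ▷ nd) α β O N 1≤q hd hI hO = extend-trans
      (extend-family ns (α ∘ suc) (β ∘ suc) (O ∘ suc) N 1≤q hd hI (hO ∘ suc)) λ N₁ inc₁ hW →
      extend-weaken (≤-reflexive (cong (_* (q ^ 2 + q ^ 2 * q ^ 2))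
          (trans (length-cartesianProductWith _,_ (allFin q) (allFin q)) (cong₂ _*_ (length-allFin q) (length-allFin q)))))
        (λ N₂ inc₂ hN → λ { zero i j → hN (i , j) (∈-cartesianProduct⁺ (∈-allFin i) (∈-allFin j))
                          ; (suc c) i j → inc₂ (hW c i j) })
        (extend-all N₁ (q ^ 2 + q ^ 2 * q ^ 2) (λ (i , j) → nodeOrOracle nd α β (O zero) W i j)
          (cartesianProduct (allFin q) (allFin q))
          λ N₂ inc₂ (i , j) → single nd N₂ i j (inc₂ (inc₁ hd)) (inc₂ ∘ inc₁ ∘ hI) (λ i → inc₂ (inc₁ (hO zero i)))
            (λ c i j → inc₂ (hW c i j)))
      where
      W = family ns (α ∘ suc) (β ∘ suc) (O ∘ suc)
      single : ∀ {l} nd (N : BNodes l) i j → Has N d → (∀ p → Has N (In p)) → (∀ i → Has N (O zero i)) →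
        (∀ c i j → Has N (W c i j)) →
        Extension N (q ^ 2 + q ^ 2 * q ^ 2) (λ N′ → Has N′ (nodeOrOracle nd α β (O zero) W i j))
      single {l} nd N i j hd hI hO hW with i Finₚ.≟ j
      ... | yes _ = extension N (m≤n+m l _) id (hO i)
      single {l} (input p) N i j hd hI hO hW | no _ = extension N (m≤n+m l _) id (hI p)
      single (gate g as) N i j hd hI hO hW | no _ =
        Combine.extend-combined (α ∘ suc) (β ∘ suc) as W N 1≤q (RealGate.arity≤2 g) hd hW _ _

-- The circuit with a local oracle obtained from a protocol

module ProtocolCLO {n s q : ℕ} (U V : Subset n) (u₀ : Nonempty U) (v₀ : Nonempty V) (p₀ : Fin n) (1≤q : 1 ≤ q)
  (ns : Nodes real n s) (out : Fin s) (α β : Protocol.Label U V q s) (sound : Protocol.Sound U V q ns α β)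
  (output : ∀ u v → u ∈ U → v ∈ V → β out v Fin.≤ α out u) where

  open Protocol U V q

  e m : ℕ
  e = s * q
  m = n + e

  In : Fin n → Fun m
  In p xs = lookup xs (p ↑ˡ e)

  O : Fin s → Fin q → Fun m
  O g i xs = lookup xs (n ↑ʳ combine g i)

  -- The default for empty combinations must itself be a node; any input variable will do.
  open Circuits In (In p₀)

  W : Family s
  W = family ns α β O

  -- The blocks of the output vary with the point, so the output becomes the argument of one further
  -- unary gate, taken on all of U and V.
  open Combine α β (out ∷ []) W

  input-extension : Extension {m} [] (length (allFin m) * 1) (λ N → ∀ i → Has N (λ xs → lookup xs i))
  input-extension = extend-weaken ≤-refl (λ _ _ has i → has i (∈-allFin i))
    (extend-all [] 1 (λ i xs → lookup xs i) (allFin m) (λ N _ → extend-input N))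

  family-extension : Extension {m} [] (s * stageCost + length (allFin m) * 1)
    (λ N → (∀ p → Has N (In p)) × (∀ c i j → Has N (W c i j)))
  family-extension = extend-trans input-extension λ N _ has →
    extend-weaken ≤-refl (λ _ inc hW → (λ p → inc (has (p ↑ˡ e))) , hW)
      (extend-family ns α β O N 1≤q (has (p₀ ↑ˡ e)) (λ p → has (p ↑ˡ e)) (λ g i → has (n ↑ʳ combine g i)))

  D-extension : Extension {m} [] (q ^ 2 + q ^ 2 * q ^ 2 + (s * stageCost + length (allFin m) * 1))
    (λ N → Has N (combined U V))
  D-extension = extend-trans {c = q ^ 2 + q ^ 2 * q ^ 2} family-extension
    λ N _ (hI , hW) → extend-combined N 1≤q (s≤s z≤n) (hI p₀) hW U V

  open Extension D-extension renaming (nodes to D-nodes)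
  open Has property

  D-circuit : MonotoneBooleanCircuit m
  D-circuit = record { nodes = D-nodes ; output = wire }

  Uᵒ Vᵒ : Fin e → Subset n
  Uᵒ j = let g , i = remQuot q j in class U (α g) i
  Vᵒ j = let g , i = remQuot q j in class V (β g) i

  D-CLO : CLO U V
  D-CLO = record
    { e = e ; D = D-circuit ; Uᵒ = Uᵒ ; Vᵒ = Vᵒ
    ; Uᵒ⊆U = λ j x x∈ → proj₁ (class⇒ U (α (proj₁ (remQuot q j))) _ x∈)
    ; Vᵒ⊆V = λ j x x∈ → proj₁ (class⇒ V (β (proj₁ (remQuot q j))) _ x∈)
    ; separates = λ f _ fU fV →
        -- Correctness speaks of pairs, so a fixed element of the other side serves as partner.
        (λ x x∈ → trans (evaluates _) (proj₁ (correct f fU fV x (proj₁ v₀) x∈ (proj₂ v₀))))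
      , (λ x x∈ → trans (evaluates _) (proj₂ (correct f fU fV (proj₁ u₀) x (proj₂ u₀) x∈)))
    }
    where
    module _ (f : Fin e → Cube n → Bool)
             (fU : ∀ j x → x ∈ Uᵒ j → f j x ≡ true) (fV : ∀ j x → x ∈ Vᵒ j → f j x ≡ false) where
      E : Cube n → Vec Bool m
      E x = x Vec.++ Vec.tabulate (λ j → f j x)

      oracle : ∀ c i x → O c i (E x) ≡ f (combine c i) x
      oracle c i x = trans (Vecₚ.lookup-++ʳ x _ (combine c i)) (Vecₚ.lookup∘tabulate _ (combine c i))

      in-class : ∀ {S} {γ : Label s} {x} → x ∈ S → ∀ c →
        let g , i = remQuot q (combine c (γ c x)) in x ∈ class S (γ g) i
      in-class {S} {γ} {x} x∈ c = subst (λ (g , i) → x ∈ class S (γ g) i)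
        (sym (Finₚ.remQuot-combine c (γ c x))) (⇒class S (γ c) x∈)

      faithful : Faithful α β O E
      faithful = record
        { inputs  = λ x p → Vecₚ.lookup-++ˡ x _ p
        ; oracleU = λ c u u∈ → trans (oracle c _ u) (fU (combine c (α c u)) u (in-class {U} {α} u∈ c))
        ; oracleV = λ c v v∈ → trans (oracle c _ v) (fV (combine c (β c v)) v (in-class {V} {β} v∈ c))
        }

      correct : ∀ u v → u ∈ U → v ∈ V → combined U V (E u) ≡ true × combined U V (E v) ≡ false
      correct = combined-correct (λ _ → id) (λ _ → id) (λ u v u∈ v∈ → zero , output u v u∈ v∈) {E}
        (family-correct ns α β O E sound faithful)

  size-bound : CLO.size D-CLO ≤ q ^ 2 + q ^ 2 * q ^ 2 + (s * stageCost + (n + s * q))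
  size-bound = ≤-trans size≤ (≤-reflexive (trans (+-identityʳ _)
    (cong (λ k → q ^ 2 + q ^ 2 * q ^ 2 + (s * stageCost + k))
      (trans (*-identityʳ (length (allFin m))) (length-allFin m)))))

  collides : Fin s → Cube n → Cube n → Bool
  collides g u v = V v ∧ (toℕ (α g u) ≡ᵇ toℕ (β g v))

  oracleUnion⇒ : ∀ u v → T (CLO.oracleUnion D-CLO (u , v)) → u ∈ U × T (any (λ g → collides g u v) (allFin s))
  oracleUnion⇒ u v h with Any.satisfied (any⁻ (λ j → (Uᵒ j ⊗ Vᵒ j) (u , v)) (allFin e) h)
  ... | j , h′ with Equivalence.to T-∧ h′
  ... | hu , hv =
    let g , i = remQuot q j
        u∈ , eu = class⇒ U (α g) i {u} hu
        v∈ , ev = class⇒ V (β g) i {v} hv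
    in u∈ , any⁺ _ (lose (∈-allFin g) (Equivalence.from T-∧ (v∈ , ≡⇒≡ᵇ _ _ (cong toℕ (trans eu (sym ev))))))

  -- In the row of u the oracle rectangles contain only those v that collide with u at some gate;
  -- the union bound over `s` gates leaves at most the fraction s / K of V.
  locality-bound : ∀ K → (∀ g u → K * count (collides g u) (cube n) ≤ count V (cube n)) →
    K * card (CLO.oracleUnion D-CLO) ≤ s * card (U ⊗ V)
  locality-bound K few = count-cartesianProduct (CLO.oracleUnion D-CLO) (U ⊗ V) K s (cube n) (cube n) row
    where
    open ≤-Reasoning
    row : ∀ u → K * count (λ v → CLO.oracleUnion D-CLO (u , v)) (cube n) ≤ s * count (λ v → (U ⊗ V) (u , v)) (cube n)
    row u with T? (U u)
    ... | no u∉ = begin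
      K * count (λ v → CLO.oracleUnion D-CLO (u , v)) (cube n)
        ≤⟨ *-monoʳ-≤ K (count-mono (λ v h → ⊥-elim (u∉ (proj₁ (oracleUnion⇒ u v h)))) (cube n)) ⟩
      K * count {A = Cube n} (λ _ → false) (cube n)
        ≡⟨ trans (cong (K *_) (count-false (cube n))) (*-zeroʳ K) ⟩
      0 ≤⟨ z≤n ⟩
      s * count (λ v → (U ⊗ V) (u , v)) (cube n) ∎
    ... | yes u∈ = begin
      K * count (λ v → CLO.oracleUnion D-CLO (u , v)) (cube n)
        ≤⟨ *-monoʳ-≤ K (count-mono (λ v h → proj₂ (oracleUnion⇒ u v h)) (cube n)) ⟩
      K * count (λ v → any (λ g → collides g u v) (allFin s)) (cube n)
        ≤⟨ count-any (λ g → collides g u) (allFin s) (cube n) K _ (λ g → few g u) ⟩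
      length (allFin s) * count V (cube n)
        ≡⟨ cong (_* count V (cube n)) (length-allFin s) ⟩
      s * count V (cube n)
        ≤⟨ *-monoʳ-≤ s (count-mono (λ v v∈ → Equivalence.from T-∧ (u∈ , v∈)) (cube n)) ⟩
      s * count (λ v → (U ⊗ V) (u , v)) (cube n) ∎

-- Ranks of the gate values

0<½* : ∀ {δ} → 0ℚ ℚ.< δ → 0ℚ ℚ.< ½ ℚ.* δ
0<½* {δ} 0<δ = ℚₚ.positive⁻¹ _ {{ℚₚ.pos*pos⇒pos ½ δ {{ℚ.positive 0<δ}}}}

½δ+½δ≡δ : ∀ δ → ½ ℚ.* δ ℚ.+ ½ ℚ.* δ ≡ δ
½δ+½δ≡δ δ = trans (sym (ℚₚ.*-distribʳ-+ δ ½ ½)) (ℚₚ.*-identityˡ δ)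

p≤p+δ : ∀ p {δ} → 0ℚ ℚ.< δ → p ℚ.≤ p ℚ.+ δ
p≤p+δ p {δ} 0<δ = subst (ℚ._≤ p ℚ.+ δ) (ℚₚ.+-identityʳ p) (ℚₚ.+-monoʳ-≤ p (ℚₚ.<⇒≤ 0<δ))

eventually-≤⇒≤ℝ : ∀ {x y} N → (∀ n → N ≤ n → seq x n ℚ.≤ seq y n) → x ≤ℝ y
eventually-≤⇒≤ℝ {x} {y} N h δ 0<δ = N , λ n N≤n → ℚₚ.≤-trans (h n N≤n) (p≤p+δ (seq y n) 0<δ)

≤ℝ-refl : ∀ {x} → x ≤ℝ x
≤ℝ-refl {x} = eventually-≤⇒≤ℝ {x} {x} 0 λ _ _ → ℚₚ.≤-refl

≤ℝ-trans : ∀ {x y z} → x ≤ℝ y → y ≤ℝ z → x ≤ℝ z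
≤ℝ-trans {x} {y} {z} x≤y y≤z δ 0<δ with x≤y (½ ℚ.* δ) (0<½* 0<δ) | y≤z (½ ℚ.* δ) (0<½* 0<δ)
... | M , h | N , k = M ⊔ N , λ n M⊔N≤n → begin
  seq x n                               ≤⟨ h n (m⊔n≤o⇒m≤o M N M⊔N≤n) ⟩
  seq y n ℚ.+ ½ ℚ.* δ                   ≤⟨ ℚₚ.+-monoˡ-≤ (½ ℚ.* δ) (k n (m⊔n≤o⇒n≤o M N M⊔N≤n)) ⟩
  seq z n ℚ.+ ½ ℚ.* δ ℚ.+ ½ ℚ.* δ       ≡⟨ ℚₚ.+-assoc (seq z n) (½ ℚ.* δ) (½ ℚ.* δ) ⟩
  seq z n ℚ.+ (½ ℚ.* δ ℚ.+ ½ ℚ.* δ)     ≡⟨ cong (seq z n ℚ.+_) (½δ+½δ≡δ δ) ⟩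
  seq z n ℚ.+ δ                         ∎
  where open ℚₚ.≤-Reasoning

p-q≤r⇒p≤q+r : ∀ p q r → p ℚ.- q ℚ.≤ r → p ℚ.≤ q ℚ.+ r
p-q≤r⇒p≤q+r p q r h = subst (ℚ._≤ q ℚ.+ r) (trans (sym (ℚₚ.+-assoc q p (ℚ.- q)))
    (trans (cong (ℚ._- q) (ℚₚ.+-comm q p)) (trans (ℚₚ.+-assoc p q (ℚ.- q))
      (trans (cong (p ℚ.+_) (ℚₚ.+-inverseʳ q)) (ℚₚ.+-identityʳ p)))))
  (ℚₚ.+-monoʳ-≤ q h)

p≤∣p∣ : ∀ p → p ℚ.≤ ℚ.∣ p ∣
p≤∣p∣ p with ℚₚ.≤-total 0ℚ p
... | inj₁ 0≤p = ℚₚ.≤-reflexive (sym (ℚₚ.0≤p⇒∣p∣≡p 0≤p))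
... | inj₂ p≤0 = ℚₚ.≤-trans p≤0 (ℚₚ.0≤∣p∣ p)

close⇒≤ : ∀ p q {δ} → ℚ.∣ p ℚ.- q ∣ ℚ.≤ δ → p ℚ.≤ q ℚ.+ δ
close⇒≤ p q {δ} h = p-q≤r⇒p≤q+r p q δ (ℚₚ.≤-trans (p≤∣p∣ (p ℚ.- q)) h)

-- After a stage L both sequences move by at most δ/4.  If y ≤ x + δ/2 at L, then y ≤ x + δ from L on;
-- otherwise x ≤ y from L on.
≰ℝ⇒≥ℝ : ∀ {x y} → ¬ x ≤ℝ y → y ≤ℝ x
≰ℝ⇒≥ℝ {x} {y} x≰y δ 0<δ
  with cauchy x (½ ℚ.* (½ ℚ.* δ)) (0<½* (0<½* 0<δ)) | cauchy y (½ ℚ.* (½ ℚ.* δ)) (0<½* (0<½* 0<δ))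
... | M , h | N , k with ℚₚ.≤-total (seq y (M ⊔ N)) (seq x (M ⊔ N) ℚ.+ ½ ℚ.* δ)
... | inj₁ yL≤xL+ = L , λ n L≤n → begin
  seq y n                          ≤⟨ close⇒≤ (seq y n) (seq y L) (k n L (m⊔n≤o⇒n≤o M N L≤n) (m≤n⊔m M N)) ⟩
  seq y L ℚ.+ η                    ≤⟨ ℚₚ.+-monoˡ-≤ η {seq y L} {seq x L ℚ.+ ½ ℚ.* δ} yL≤xL+ ⟩
  seq x L ℚ.+ ½ ℚ.* δ ℚ.+ η        ≤⟨ ℚₚ.+-monoˡ-≤ η {seq x L ℚ.+ ½ ℚ.* δ} {seq x n ℚ.+ η ℚ.+ ½ ℚ.* δ}
                                        (ℚₚ.+-monoˡ-≤ (½ ℚ.* δ) {seq x L} {seq x n ℚ.+ η}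
                                          (close⇒≤ (seq x L) (seq x n) (h L n (m≤m⊔n M N) (m⊔n≤o⇒m≤o M N L≤n)))) ⟩
  seq x n ℚ.+ η ℚ.+ ½ ℚ.* δ ℚ.+ η  ≡⟨ sum (seq x n) ⟩
  seq x n ℚ.+ δ                    ∎
  where
  open ℚₚ.≤-Reasoning
  L = M ⊔ N
  η = ½ ℚ.* (½ ℚ.* δ)
  sum : ∀ p → p ℚ.+ η ℚ.+ ½ ℚ.* δ ℚ.+ η ≡ p ℚ.+ δ
  sum p = solve 2 (λ p δ → p :+ con ½ :* (con ½ :* δ) :+ con ½ :* δ :+ con ½ :* (con ½ :* δ) := p :+ δ) refl p δ
    where open Data.Rational.Solver.+-*-Solver
... | inj₂ xL+≤yL = ⊥-elim (x≰y (eventually-≤⇒≤ℝ {x} {y} L λ n L≤n → begin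
  seq x n                          ≤⟨ close⇒≤ (seq x n) (seq x L) (h n L (m⊔n≤o⇒m≤o M N L≤n) (m≤m⊔n M N)) ⟩
  seq x L ℚ.+ η                    ≤⟨ shift (seq x L) (seq y L) (seq y n) xL+≤yL
                                        (close⇒≤ (seq y L) (seq y n) (k L n (m≤n⊔m M N) (m⊔n≤o⇒n≤o M N L≤n))) ⟩
  seq y n                          ∎))
  where
  open ℚₚ.≤-Reasoning
  L = M ⊔ N
  η = ½ ℚ.* (½ ℚ.* δ)
  shift : ∀ a b c → a ℚ.+ ½ ℚ.* δ ℚ.≤ b → b ℚ.≤ c ℚ.+ η → a ℚ.+ η ℚ.≤ c
  shift a b c p q = subst₂ ℚ._≤_
    (trans (ℚₚ.+-assoc a (½ ℚ.* δ) (ℚ.- η)) (cong (a ℚ.+_) half))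
    (trans (ℚₚ.+-assoc c η (ℚ.- η)) (trans (cong (c ℚ.+_) (ℚₚ.+-inverseʳ η)) (ℚₚ.+-identityʳ c)))
    (ℚₚ.+-monoˡ-≤ (ℚ.- η) (ℚₚ.≤-trans p q))
    where
    half : ½ ℚ.* δ ℚ.- η ≡ η
    half = solve 1 (λ δ → con ½ :* δ :- con ½ :* (con ½ :* δ) := con ½ :* (con ½ :* δ)) refl δ
      where open Data.Rational.Solver.+-*-Solver

1≰ℝ0 : ¬ 1ℝ ≤ℝ 0ℝ
1≰ℝ0 1≤0 with 1≤0 ½ (ℚₚ.positive⁻¹ ½)
... | N , h = ℚₚ.<-irrefl refl (ℚₚ.<-≤-trans (toWitness {a? = 0ℚ ℚ.+ ½ ℚₚ.<? 1ℚ} _) (h N ≤-refl))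

bit-mono : ∀ {a b} → a Bool.≤ b → bit a ≤ℝ bit b
bit-mono {a} b≤b = ≤ℝ-refl {bit a}
bit-mono f≤t = eventually-≤⇒≤ℝ {0ℝ} {1ℝ} 0 λ _ _ → ℚₚ.<⇒≤ (ℚₚ.positive⁻¹ 1ℚ)

-- Double-negation shift, available because the index set is finite.
¬¬-Fin : ∀ {n} {P : Fin n → Set} → (∀ i → ¬ ¬ P i) → ¬ ¬ (∀ i → P i)
¬¬-Fin {zero} h k = k λ ()
¬¬-Fin {suc n} h k = h zero λ p → ¬¬-Fin (h ∘ suc) λ ps → k λ { zero → p ; (suc i) → ps i }

count-strict : ∀ {A : Set} {P Q : A → Bool} → (∀ x → T (P x) → T (Q x)) →
  ∀ {x} → T (Q x) → ¬ T (P x) → ∀ {xs} → x ∈ˡ xs → count P xs < count Q xs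
count-strict {P = P} {Q} P⇒Q {x} Qx ¬Px {xs} x∈ = begin-strict
  count P xs
    <⟨ m<m+n (count P xs) (∈-length (∈-filter⁺ (T? ∘ Q∖P) x∈
         (Equivalence.from T-∧ (Qx , fromWitness {a? = ¬? (T? (P x))} ¬Px)))) ⟩
  count P xs + count Q∖P xs
    ≤⟨ count-disjoint P⇒Q (λ y → proj₁ ∘ Equivalence.to T-∧)
         (λ y p h → toWitness {a? = ¬? (T? (P y))} (proj₂ (Equivalence.to T-∧ h)) p) xs ⟩
  count Q xs ∎
  where
  open ≤-Reasoning
  Q∖P : _ → Bool
  Q∖P y = Q y ∧ ⌊ ¬? (T? (P y)) ⌋

∀-cube? : ∀ {n} {P : Cube n → Set} → (∀ x → Dec (P x)) → Dec (∀ x → P x)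
∀-cube? {n} P? = Dec.map′ (λ h x → All.lookup h (∈-cube x)) (λ h → All.universal h (cube n)) (All.all? P? (cube n))

Ranking : ℕ → ℕ → Set
Ranking n k = Fin k → Cube n → ℕ

-- What the protocol takes from monotonicity, phrased with ranks so that it becomes decidable.
NodeValid : ∀ {n k} → Node real n k → Ranking n (suc k) → Set
NodeValid (input p) r = ∀ x y → r zero y < r zero x → lookup x p ≡ true × lookup y p ≡ false
NodeValid (gate g as) r = ∀ x y → r zero y < r zero x → ∃[ c ] r (suc (lookup as c)) y < r (suc (lookup as c)) x

Valid : ∀ {n k} → Nodes real n k → Ranking n k → Set
Valid []        r = ⊤
Valid (ns ▷ nd) r = NodeValid nd r × Valid ns (r ∘ suc)

nodeValid? : ∀ {n k} (nd : Node real n k) r → Dec (NodeValid nd r)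
nodeValid? (input p) r = ∀-cube? λ x → ∀-cube? λ y →
  (r zero y <? r zero x) →-dec ((lookup x p Boolₚ.≟ true) ×-dec (lookup y p Boolₚ.≟ false))
nodeValid? (gate g as) r = ∀-cube? λ x → ∀-cube? λ y →
  (r zero y <? r zero x) →-dec Finₚ.any? (λ c → r (suc (lookup as c)) y <? r (suc (lookup as c)) x)

valid? : ∀ {n k} (ns : Nodes real n k) r → Dec (Valid ns r)
valid? []        r = yes tt
valid? (ns ▷ nd) r = nodeValid? nd r ×-dec valid? ns (r ∘ suc)

value : ∀ {n k} → Nodes real n k → Fin k → Cube n → ℝ
value ns g x = lookup (evalNodes ns (Vec.map bit x)) g

Representing : ∀ {n k} → Nodes real n k → Ranking n k → Set
Representing ns r = ∀ g x y →
  (r g x ≤ r g y → value ns g x ≤ℝ value ns g y) × (value ns g x ≤ℝ value ns g y → r g x ≤ r g y)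

pointwise-map : ∀ {A B : Set} {_∼_ : B → B → Set} {f g : A → B} {m} (as : Vec A m) →
  (∀ c → f (lookup as c) ∼ g (lookup as c)) → Pointwise _∼_ (Vec.map f as) (Vec.map g as)
pointwise-map []       h = []
pointwise-map (a ∷ as) h = h zero ∷ pointwise-map as (h ∘ suc)

-- Monotonicity by contraposition: if no argument ranks y strictly below x, the arguments at x are
-- pointwise at most those at y, hence so is the gate value.
representing⇒valid : ∀ {n k} (ns : Nodes real n k) r → Representing ns r → Valid ns r
representing⇒valid [] r ref = tt
representing⇒valid (ns ▷ nd) r ref = node nd ref , representing⇒valid ns (r ∘ suc) (ref ∘ suc)
  where
  node : ∀ nd → Representing (ns ▷ nd) r → NodeValid nd r
  node (input p) ref x y lt with lookup x p in ex | lookup y p in ey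
  ... | true  | false = refl , refl
  ... | true  | true  = ⊥-elim (<⇒≱ lt (proj₂ (ref zero x y) (≤-lookup (subst₂ Bool._≤_ (sym ex) (sym ey) b≤b))))
    where
    ≤-lookup : lookup x p Bool.≤ lookup y p → value (ns ▷ input p) zero x ≤ℝ value (ns ▷ input p) zero y
    ≤-lookup h = subst₂ _≤ℝ_ (sym (Vecₚ.lookup-map p bit x)) (sym (Vecₚ.lookup-map p bit y)) (bit-mono h)
  ... | false | b = ⊥-elim (<⇒≱ lt (proj₂ (ref zero x y) (subst₂ _≤ℝ_
      (sym (Vecₚ.lookup-map p bit x)) (sym (Vecₚ.lookup-map p bit y))
      (bit-mono (subst₂ Bool._≤_ (sym ex) (sym ey) (Boolₚ.≤-minimum b))))))
  node (gate g as) ref x y lt with Finₚ.any? (λ c → r (suc (lookup as c)) y <? r (suc (lookup as c)) x)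
  ... | yes found = found
  ... | no none = ⊥-elim (<⇒≱ lt (proj₂ (ref zero x y) (RealGate.mono g (pointwise-map as
          λ c → proj₁ (ref (suc (lookup as c)) x y) (≮⇒≥ λ lt′ → none (c , lt′))))))

module Tables (n s : ℕ) where

  L : ℕ
  L = length (cube n)

  position : Cube n → Fin L
  position x = Any.index (∈-cube x)

  -- The table of all comparisons is coded as a point of a cube so that `∃-cube?` can search for a
  -- suitable one.
  Table : Set
  Table = Cube (s * (L * L))

  cell : Fin s → Cube n → Cube n → Fin (s * (L * L))
  cell g x y = combine g (combine (position x) (position y))

  -- When the bits record comparisons of values, this is the size of the down-set of x, which turns
  -- a total preorder into numbers.
  rank : Table → Ranking n s
  rank t g x = count (λ y → lookup t (cell g x y)) (cube n)

  uncell : Fin (s * (L * L)) → Fin s × Cube n × Cube n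
  uncell k = cubes (remQuot (L * L) k)
    where
    cubes : Fin s × Fin (L * L) → Fin s × Cube n × Cube n
    cubes (g , ab) = g , Product.map (List.lookup (cube n)) (List.lookup (cube n)) (remQuot L ab)

  uncell-cell : ∀ g x y → uncell (cell g x y) ≡ (g , x , y)
  uncell-cell g x y = trans
    (cong (λ (g , ab) → g , Product.map (List.lookup (cube n)) (List.lookup (cube n)) (remQuot {L} L ab))
      (Finₚ.remQuot-combine g (combine (position x) (position y))))
    (trans (cong (λ (a , b) → g , List.lookup (cube n) a , List.lookup (cube n) b)
        (Finₚ.remQuot-combine (position x) (position y)))
      (cong₂ (λ x y → g , x , y) (sym (lookup-index (∈-cube x))) (sym (lookup-index (∈-cube y)))))

  -- Excluded middle holds up to double negation for finitely many comparisons at once. After that,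
  -- ranks reflect the order: if the value at x is not at most the value at y, totality gives the
  -- reverse, and the down-set of x strictly contains that of y, as it contains x itself.
  representing-table : (ns : Nodes real n s) → ¬ ¬ (∃[ t ] Representing ns (rank t))
  representing-table ns none = ¬¬-Fin (λ k → ¬¬-excluded-middle {A = Q (uncell k)}) λ d →
    none (table d , representing d)
    where
    Q : Fin s × Cube n × Cube n → Set
    Q (g , x , y) = value ns g y ≤ℝ value ns g x

    module _ (d : ∀ k → Dec (Q (uncell k))) where
      table : Table
      table = Vec.tabulate (λ k → ⌊ d k ⌋)

      entry : ∀ g x y → lookup table (cell g x y) ≡ ⌊ d (cell g x y) ⌋
      entry g x y = Vecₚ.lookup∘tabulate (λ k → ⌊ d k ⌋) (cell g x y)

      entry⇒ : ∀ {g x y} → T (lookup table (cell g x y)) → value ns g y ≤ℝ value ns g x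
      entry⇒ {g} {x} {y} h = subst Q (uncell-cell g x y) (toWitness (subst T (entry g x y) h))

      ⇒entry : ∀ {g x y} → value ns g y ≤ℝ value ns g x → T (lookup table (cell g x y))
      ⇒entry {g} {x} {y} h = subst T (sym (entry g x y)) (fromWitness (subst Q (sym (uncell-cell g x y)) h))

      ≤ℝ? : ∀ g x y → Dec (value ns g y ≤ℝ value ns g x)
      ≤ℝ? g x y = Dec.map′ entry⇒ ⇒entry (T? (lookup table (cell g x y)))

      representing : Representing ns (rank table)
      representing g x y = to , λ x≤y → count-mono (λ z h →
        ⇒entry (≤ℝ-trans {value ns g z} {value ns g x} {value ns g y} (entry⇒ h) x≤y)) (cube n)
        where
        to : rank table g x ≤ rank table g y → value ns g x ≤ℝ value ns g y
        to r≤ with ≤ℝ? g y x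
        ... | yes x≤y = x≤y
        ... | no x≰y = ⊥-elim (<⇒≱ (count-strict
          (λ z h → ⇒entry (≤ℝ-trans {value ns g z} {value ns g y} {value ns g x} (entry⇒ h)
            (≰ℝ⇒≥ℝ {value ns g x} {value ns g y} x≰y)))
          {x} (⇒entry (≤ℝ-refl {value ns g x})) (x≰y ∘ entry⇒) (∈-cube x)) r≤)

-- Real comparisons are undecidable, but only finitely many rank tables exist and
-- being an adequate one is decidable, so double-negated existence is enough.
adequate-ranking : ∀ {n} (U V : Subset n) (C : MonotoneRealCircuit n) → RealSeparates C U V →
  ∃[ r ] (Valid (Circuit.nodes C) r × (∀ u v → u ∈ U → v ∈ V → r (Circuit.output C) v < r (Circuit.output C) u))
adequate-ranking {n} U V C (sepU , sepV) =
  let t , adequate = decidable-stable (∃-cube? adequate?) exists in rank t , adequate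
  where
  open Circuit C
  open Tables n size
  Adequate : Table → Set
  Adequate t = Valid nodes (rank t) × (∀ u v → u ∈ U → v ∈ V → rank t output v < rank t output u)
  adequate? : ∀ t → Dec (Adequate t)
  adequate? t = valid? nodes (rank t) ×-dec
    ∀-cube? λ u → ∀-cube? λ v → T? (U u) →-dec (T? (V v) →-dec (rank t output v <? rank t output u))
  exists : ¬ ¬ (∃[ t ] Adequate t)
  exists none = representing-table nodes λ { (t , ref) → none (t , representing⇒valid nodes (rank t) ref ,
    λ u v u∈ v∈ →
    ≰⇒> λ r≤ → 1≰ℝ0 (≤ℝ-trans {1ℝ} {value nodes output u} {0ℝ} (proj₂ (sepU u u∈))
      (≤ℝ-trans {value nodes output u} {value nodes output v} {0ℝ} (proj₁ (ref output u v) r≤) (proj₁ (sepV v v∈))))) }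

-- Oracle circuits from ranks

module _ {n q : ℕ} (U V : Subset n) where
  open Protocol U V q

  -- By `below` a strict label inequality is a strict rank inequality; validity passes it to an
  -- argument, where `above` weakens it to labels again.
  valid⇒sound : ∀ {k} (ns : Nodes real n k) r (α β : Label k) → Valid ns r →
    (∀ g u v → r g v < r g u → β g v Fin.≤ α g u) → (∀ g u v → r g u ≤ r g v → α g u Fin.≤ β g v) →
    Sound ns α β
  valid⇒sound [] r α β _ _ _ = tt
  valid⇒sound (ns ▷ nd) r α β (valid , valids) above below =
    node nd valid , valid⇒sound ns (r ∘ suc) (α ∘ suc) (β ∘ suc) valids (above ∘ suc) (below ∘ suc)
    where
    r< : ∀ {u v} → β zero v Fin.< α zero u → r zero v < r zero u
    r< {u} {v} lt = ≰⇒> λ r≤ → <⇒≱ lt (below zero u v r≤)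
    node : ∀ nd → NodeValid nd r → NodeSound nd α β
    node (input p)   valid u v _ _ lt = valid u v (r< lt)
    node (gate g as) valid u v _ _ lt = let c , r<′ = valid u v (r< lt) in c , above (suc (lookup as c)) u v r<′

-- q is suc (2 * K), as a variable because powers of suc (2 * K) would be unfolded.
module RankedCLO {n} (U V : Subset n) (U≠∅ : Nonempty U) (V≠∅ : Nonempty V) (p₀ : Fin n)
                 (C : MonotoneRealCircuit n) (separates : RealSeparates C U V)
                 (K q : ℕ) (q≡ : q ≡ suc (2 * K)) where
  open Circuit C renaming (size to s)

  r : Ranking n s
  r = proj₁ (adequate-ranking U V C separates)

  instance
    V-nonZero : NonZero (count V (cube n))
    V-nonZero = >-nonZero (∈-length (∈-filter⁺ (T? ∘ V) (∈-cube (proj₁ V≠∅)) (proj₂ V≠∅)))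

  module Quantile (g : Fin s) = Quantiles (cube n) ∈-cube V (r g) K

  a<q : ∀ g u → Quantile.a g u < q
  a<q g u = subst (Quantile.a g u <_) (sym q≡) (Quantile.a< g u)

  b<q : ∀ g v → Quantile.b g v < q
  b<q g v = subst (Quantile.b g v <_) (sym q≡) (Quantile.b< g v)

  α β : Protocol.Label U V q s
  α g u = fromℕ< (a<q g u)
  β g v = fromℕ< (b<q g v)

  β≤α : ∀ g u v → r g v < r g u → β g v Fin.≤ α g u
  β≤α g u v lt = subst₂ _≤_ (sym (Finₚ.toℕ-fromℕ< _)) (sym (Finₚ.toℕ-fromℕ< _)) (Quantile.r<⇒b≤a g u v lt)

  α≤β : ∀ g u v → r g u ≤ r g v → α g u Fin.≤ β g v
  α≤β g u v le = subst₂ _≤_ (sym (Finₚ.toℕ-fromℕ< _)) (sym (Finₚ.toℕ-fromℕ< _)) (Quantile.r≤⇒a≤b g u v le)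

  open ProtocolCLO U V U≠∅ V≠∅ p₀ (subst (1 ≤_) (sym q≡) (s≤s z≤n)) nodes output α β
    (valid⇒sound U V nodes r α β (proj₁ (proj₂ (adequate-ranking U V C separates))) β≤α α≤β)
    (λ u v u∈ v∈ → β≤α output u v (proj₂ (proj₂ (adequate-ranking U V C separates)) u v u∈ v∈))
    public

  few-collisions : ∀ g u → K * count (collides g u) (cube n) ≤ count V (cube n)
  few-collisions g u = subst (λ k → K * k ≤ count V (cube n))
    (cong length (filter-cong eq)) (Quantile.few-collisions g u)
    where
    filter-cong : ∀ {P Q : Cube n → Bool} → (∀ x → P x ≡ Q x) → filterᵇ P (cube n) ≡ filterᵇ Q (cube n)
    filter-cong eq = Listₚ.filter-≐ _ _ ((λ {x} → subst T (eq x)) , (λ {x} → subst T (sym (eq x)))) (cube n)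
    eq : ∀ v → (V v Bool.∧ (Quantile.a g u ≡ᵇ Quantile.b g v)) ≡ collides g u v
    eq v = cong (V v Bool.∧_) (cong₂ _≡ᵇ_ (sym (Finₚ.toℕ-fromℕ< (a<q g u))) (sym (Finₚ.toℕ-fromℕ< (b<q g v))))

-- The highest power q⁶ is at most Z¹². Once the lower terms are also multiplied by s, six such
-- summands remain, and 6 ≤ 2³ ≤ Z³ yields the exponent 15.
size-polynomial : ∀ n s q Z → 1 ≤ s → 2 ≤ Z → n ≤ Z → q ≤ Z ^ 2 →
  q ^ 2 + q ^ 2 * q ^ 2 + (s * (q * q * (q ^ 2 + q ^ 2 * q ^ 2)) + (n + s * q)) ≤ s * Z ^ 15
size-polynomial n s q Z 1≤s 2≤Z n≤Z q≤Z² = begin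
  q ^ 2 + q ^ 2 * q ^ 2 + (s * (q * q * (q ^ 2 + q ^ 2 * q ^ 2)) + (n + s * q))
    ≡⟨ solve 3 (λ n s q → q :^ 2 :+ q :^ 2 :* q :^ 2 :+
          (s :* (q :* q :* (q :^ 2 :+ q :^ 2 :* q :^ 2)) :+ (n :+ s :* q))
        := q :^ 2 :+ q :^ 4 :+ n :+ s :* (q :^ 4 :+ q :^ 6 :+ q :^ 1)) refl n s q ⟩
  q ^ 2 + q ^ 4 + n + s * (q ^ 4 + q ^ 6 + q ^ 1)
    ≤⟨ +-mono-≤ (+-mono-≤ (+-mono-≤ (q^ 2) (q^ 4)) (≤-trans n≤Z (≤-trans (≤-reflexive (sym (^-identityʳ Z))) (Z^ 1))))
         (*-monoʳ-≤ s (+-mono-≤ (+-mono-≤ (q^ 4) (q^ 6)) (q^ 1))) ⟩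
  Z¹² + Z¹² + Z¹² + s * (Z¹² + Z¹² + Z¹²)
    ≤⟨ +-monoˡ-≤ _ (m≤n*m (Z¹² + Z¹² + Z¹²) s {{>-nonZero 1≤s}}) ⟩
  s * (Z¹² + Z¹² + Z¹²) + s * (Z¹² + Z¹² + Z¹²)
    ≡⟨ solve 2 (λ s b → s :* (b :+ b :+ b) :+ s :* (b :+ b :+ b) := s :* (con 6 :* b)) refl s Z¹² ⟩
  s * (6 * Z¹²)
    ≤⟨ *-monoʳ-≤ s (*-monoˡ-≤ Z¹² (≤-trans (≤ᵇ⇒≤ 6 8 tt) (^-monoˡ-≤ 3 2≤Z))) ⟩
  s * (Z ^ 3 * Z¹²)
    ≡⟨ cong (s *_) (^-distribˡ-+-* Z 3 12) ⟨
  s * Z ^ 15 ∎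
  where
  open ≤-Reasoning
  open Data.Nat.Solver.+-*-Solver
  Z¹² = Z ^ 12
  Z^ : ∀ k {h : T (k ≤ᵇ 12)} → Z ^ k ≤ Z¹²
  Z^ k {h} = ^-monoʳ-≤ Z {{>-nonZero (≤-trans (s≤s z≤n) 2≤Z)}} (≤ᵇ⇒≤ k 12 h)
  q^ : ∀ k {h : T (2 * k ≤ᵇ 12)} → q ^ k ≤ Z¹²
  q^ k {h} = begin
    q ^ k          ≤⟨ ^-monoˡ-≤ k q≤Z² ⟩
    (Z ^ 2) ^ k    ≡⟨ ^-*-assoc Z 2 k ⟩
    Z ^ (2 * k)    ≤⟨ Z^ (2 * k) {h} ⟩
    Z¹²              ∎

polynomial-bound : ∀ n s K q → q ≡ suc (2 * K) → 1 ≤ n → 1 ≤ s → 1 ≤ K →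
  q ^ 2 + q ^ 2 * q ^ 2 + (s * (q * q * (q ^ 2 + q ^ 2 * q ^ 2)) + (n + s * q)) ≤ s * (2 * n * K) ^ 15
polynomial-bound n s K q q≡ 1≤n 1≤s 1≤K =
  size-polynomial n s q (2 * n * K) 1≤s 2≤Z n≤Z (subst (_≤ (2 * n * K) ^ 2) (sym q≡) q≤Z²)
  where
  open ≤-Reasoning
  2K≤Z : 2 * K ≤ 2 * n * K
  2K≤Z = *-monoˡ-≤ K {2} {2 * n} (*-monoʳ-≤ 2 1≤n)
  2≤Z : 2 ≤ 2 * n * K
  2≤Z = ≤-trans (*-monoʳ-≤ 2 1≤K) 2K≤Z
  n≤Z : n ≤ 2 * n * K
  n≤Z = ≤-trans (m≤m+n n (n + 0)) (m≤m*n (2 * n) K {{>-nonZero 1≤K}})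
  2z≤z² : ∀ z → 2 ≤ z → z + z ≤ z ^ 2
  2z≤z² z 2≤z = begin
    z + z          ≡⟨ cong (z +_) (+-identityʳ z) ⟨
    2 * z          ≤⟨ *-monoˡ-≤ z 2≤z ⟩
    z * z          ≡⟨ cong (z *_) (*-identityʳ z) ⟨
    z ^ 2          ∎
  q≤Z² : suc (2 * K) ≤ (2 * n * K) ^ 2
  q≤Z² = ≤-trans (+-mono-≤ (≤-trans (n≤1+n 1) 2≤Z) 2K≤Z) (2z≤z² (2 * n * K) 2≤Z)

1≤Fin : ∀ {m} → Fin m → 1 ≤ m
1≤Fin zero    = s≤s z≤n
1≤Fin (suc _) = s≤s z≤n

-- The integer form of the theorem, with `K` in the role of 1/ε. The exponent is a parameter, so the
-- real estimates are independent of its value.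
ApproximatingCLOs : ℕ → Set
ApproximatingCLOs k = ∀ {n} (U V : Subset n) → Nonempty U → Nonempty V → Fin n →
  (C : MonotoneRealCircuit n) → RealSeparates C U V → ∀ K → 1 ≤ K → let s = Circuit.size C in
  Σ[ D ∈ CLO U V ] (CLO.size D ≤ s * (2 * n * K) ^ k × K * card (CLO.oracleUnion D) ≤ s * card (U ⊗ V))

approximating-CLO : ApproximatingCLOs 15
approximating-CLO {n} U V U≠∅ V≠∅ p₀ C separates K 1≤K =
  D-CLO ,
  ≤-trans size-bound (polynomial-bound n (Circuit.size C) K (suc (2 * K)) refl
    (1≤Fin p₀) (1≤Fin (Circuit.output C)) 1≤K) ,
  locality-bound K few-collisions
  where open RankedCLO U V U≠∅ V≠∅ p₀ C separates K (suc (2 * K)) refl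

-- For μ ≥ 1 a single oracle rectangle may be all of U × V.
oneRectangle : ∀ {n} (U V : Subset n) → CLO U V
oneRectangle {n} U V = record
  { e = 1
  ; D = record { nodes = [] ▷ input (n Fin.↑ʳ zero) ; output = zero }
  ; Uᵒ = λ _ → U ; Vᵒ = λ _ → V ; Uᵒ⊆U = λ _ _ x∈ → x∈ ; Vᵒ⊆V = λ _ _ x∈ → x∈
  ; separates = λ f _ fU fV → (λ x x∈ → trans (Vecₚ.lookup-++ʳ x _ zero) (fU zero x x∈))
                            , (λ x x∈ → trans (Vecₚ.lookup-++ʳ x _ zero) (fV zero x x∈))
  }

oneRectangle-card : ∀ {n} (U V : Subset n) → card (CLO.oracleUnion (oneRectangle U V)) ≤ card (U ⊗ V)
oneRectangle-card {n} U V = count-mono (λ xy h → T-∨-false _ h) (cartesianProduct (cube n) (cube n))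
  where
  T-∨-false : ∀ b → T (b Bool.∨ false) → T b
  T-∨-false true _ = tt

-- For n = 1 the base s/μ can be close to 1, and then its powers absorb no constant. But here
-- closure, disjointness and non-emptiness leave only U = {1} and V = {0}, which the input
-- separates.
oneInput : ∀ (U V : Subset 1) → Disjoint U V → Nonempty U → Nonempty V → UpwardClosed U ⊎ DownwardClosed V → CLO U V
oneInput U V disjoint (u , u∈) (v , v∈) closed = record
  { e = 0
  ; D = record { nodes = [] ▷ input zero ; output = zero }
  ; Uᵒ = λ () ; Vᵒ = λ () ; Uᵒ⊆U = λ () ; Vᵒ⊆V = λ ()
  ; separates = λ _ _ _ _ → onU closed , onV closed
  }
  where
  bottom : ∀ x → (false ∷ []) ≤ᶜ x
  bottom (false ∷ []) = Bool.b≤b ∷ []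
  bottom (true ∷ []) = Bool.f≤t ∷ []
  top : ∀ x → x ≤ᶜ (true ∷ [])
  top (false ∷ []) = Bool.f≤t ∷ []
  top (true ∷ []) = Bool.b≤b ∷ []
  onU : UpwardClosed U ⊎ DownwardClosed V → ∀ x → x ∈ U → lookup (x Vec.++ []) zero ≡ true
  onU _ (true ∷ []) _ = refl
  onU (inj₁ up) (false ∷ []) x∈ = ⊥-elim (disjoint v (up _ v (bottom v) x∈) v∈)
  onU (inj₂ down) (false ∷ []) x∈ = ⊥-elim (disjoint _ x∈ (down _ v (bottom v) v∈))
  onV : UpwardClosed U ⊎ DownwardClosed V → ∀ x → x ∈ V → lookup (x Vec.++ []) zero ≡ false
  onV _ (false ∷ []) _ = refl
  onV (inj₁ up) (true ∷ []) x∈ = ⊥-elim (disjoint _ (up u _ (top u) u∈) x∈)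
  onV (inj₂ down) (true ∷ []) x∈ = ⊥-elim (disjoint u u∈ (down u _ (top u) x∈))

-- Natural numbers in the rationals

ι : ℕ → ℚ
ι k = pos k ℚ./ 1

ι-toℚᵘ : ∀ k → ℚ.toℚᵘ (ι k) ℚᵘ.≃ ℚᵘ.mkℚᵘ (pos k) 0
ι-toℚᵘ k = ℚₚ.toℚᵘ-fromℚᵘ (ℚᵘ.mkℚᵘ (pos k) 0)

ι-* : ∀ a b → ι (a * b) ≡ ι a ℚ.* ι b
ι-* a b = ℚₚ.toℚᵘ-injective (begin
  ℚ.toℚᵘ (ι (a * b))                  ≈⟨ ι-toℚᵘ (a * b) ⟩
  ℚᵘ.mkℚᵘ (pos (a * b)) 0               ≡⟨ cong (λ z → ℚᵘ.mkℚᵘ z 0) (ℤₚ.pos-* a b) ⟩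
  ℚᵘ.mkℚᵘ (pos a) 0 ℚᵘ.* ℚᵘ.mkℚᵘ (pos b) 0  ≈⟨ ℚᵘₚ.*-cong (ι-toℚᵘ a) (ι-toℚᵘ b) ⟨
  ℚ.toℚᵘ (ι a) ℚᵘ.* ℚ.toℚᵘ (ι b)        ≈⟨ ℚₚ.toℚᵘ-homo-* (ι a) (ι b) ⟨
  ℚ.toℚᵘ (ι a ℚ.* ι b)                  ∎)
  where open ℚᵘₚ.≃-Reasoning

ι-+ : ∀ a b → ι (a + b) ≡ ι a ℚ.+ ι b
ι-+ a b = ℚₚ.toℚᵘ-injective (begin
  ℚ.toℚᵘ (ι (a + b))                  ≈⟨ ι-toℚᵘ (a + b) ⟩
  ℚᵘ.mkℚᵘ (pos (a + b)) 0               ≡⟨ cong (λ z → ℚᵘ.mkℚᵘ z 0) (trans (ℤₚ.pos-+ a b)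
                                            (sym (cong₂ ℤ._+_ (ℤₚ.*-identityʳ (pos a)) (ℤₚ.*-identityʳ (pos b))))) ⟩
  ℚᵘ.mkℚᵘ (pos a) 0 ℚᵘ.+ ℚᵘ.mkℚᵘ (pos b) 0  ≈⟨ ℚᵘₚ.+-cong (ι-toℚᵘ a) (ι-toℚᵘ b) ⟨
  ℚ.toℚᵘ (ι a) ℚᵘ.+ ℚ.toℚᵘ (ι b)        ≈⟨ ℚₚ.toℚᵘ-homo-+ (ι a) (ι b) ⟨
  ℚ.toℚᵘ (ι a ℚ.+ ι b)                  ∎)
  where open ℚᵘₚ.≃-Reasoning

ι-mono : ∀ {a b} → a ≤ b → ι a ℚ.≤ ι b
ι-mono {a} {b} a≤b = ℚₚ.toℚᵘ-cancel-≤ (ℚᵘₚ.≤-respˡ-≃ (ℚᵘₚ.≃-sym (ι-toℚᵘ a)) (ℚᵘₚ.≤-respʳ-≃ (ℚᵘₚ.≃-sym (ι-toℚᵘ b))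
  (ℚᵘ.*≤* (ℤₚ.*-monoʳ-≤-nonNeg (pos 1) (ℤ.+≤+ a≤b)))))

0≤ι : ∀ k → 0ℚ ℚ.≤ ι k
0≤ι k = ι-mono {0} {k} z≤n

0<ι : ∀ k .{{_ : NonZero k}} → 0ℚ ℚ.< ι k
0<ι (suc k) = ℚₚ.<-≤-trans (ℚₚ.positive⁻¹ 1ℚ) (ι-mono {1} {suc k} (s≤s z≤n))

/-*ι : ∀ a b .{{_ : NonZero b}} → (pos a ℚ./ b) ℚ.* ι b ≡ ι a
/-*ι a (suc b) = ℚₚ.toℚᵘ-injective (begin
  ℚ.toℚᵘ ((pos a ℚ./ suc b) ℚ.* ι (suc b))              ≈⟨ ℚₚ.toℚᵘ-homo-* (pos a ℚ./ suc b) (ι (suc b)) ⟩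
  ℚ.toℚᵘ (pos a ℚ./ suc b) ℚᵘ.* ℚ.toℚᵘ (ι (suc b))
    ≈⟨ ℚᵘₚ.*-cong (ℚₚ.toℚᵘ-fromℚᵘ (ℚᵘ.mkℚᵘ (pos a) b)) (ι-toℚᵘ (suc b)) ⟩
  ℚᵘ.mkℚᵘ (pos a) b ℚᵘ.* ℚᵘ.mkℚᵘ (pos (suc b)) 0            ≈⟨ ℚᵘ.*≡* (ℤₚ.*-assoc (pos a) (pos (suc b)) (pos 1)) ⟩
  ℚᵘ.mkℚᵘ (pos a) 0                                     ≈⟨ ι-toℚᵘ a ⟨
  ℚ.toℚᵘ (ι a)                                        ∎)
  where open ℚᵘₚ.≃-Reasoning

*-monoʳ : ∀ {p q} r → 0ℚ ℚ.≤ r → p ℚ.≤ q → r ℚ.* p ℚ.≤ r ℚ.* q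
*-monoʳ r 0≤r = ℚₚ.*-monoˡ-≤-nonNeg r {{ℚ.nonNegative 0≤r}}

*-monoˡ : ∀ {p q} r → 0ℚ ℚ.≤ r → p ℚ.≤ q → p ℚ.* r ℚ.≤ q ℚ.* r
*-monoˡ r 0≤r = ℚₚ.*-monoʳ-≤-nonNeg r {{ℚ.nonNegative 0≤r}}

*-cancelʳ : ∀ {p q} r → 0ℚ ℚ.< r → p ℚ.* r ℚ.≤ q ℚ.* r → p ℚ.≤ q
*-cancelʳ r 0<r = ℚₚ.*-cancelʳ-≤-pos r {{ℚ.positive 0<r}}

0≤* : ∀ {p q} → 0ℚ ℚ.≤ p → 0ℚ ℚ.≤ q → 0ℚ ℚ.≤ p ℚ.* q
0≤* {p} {q} 0≤p 0≤q = subst (ℚ._≤ p ℚ.* q) (ℚₚ.*-zeroʳ p) (*-monoʳ p 0≤p 0≤q)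

0≤^ : ∀ {p} k → 0ℚ ℚ.≤ p → 0ℚ ℚ.≤ p ^ℚ k
0≤^ zero 0≤p = ℚₚ.<⇒≤ (ℚₚ.positive⁻¹ 1ℚ)
0≤^ (suc k) 0≤p = 0≤* 0≤p (0≤^ k 0≤p)

^-mono : ∀ {p q} k → 0ℚ ℚ.≤ p → p ℚ.≤ q → p ^ℚ k ℚ.≤ q ^ℚ k
^-mono zero 0≤p p≤q = ℚₚ.≤-refl
^-mono {p} {q} (suc k) 0≤p p≤q = ℚₚ.≤-trans (*-monoˡ (p ^ℚ k) (0≤^ k 0≤p) p≤q)
  (*-monoʳ q (ℚₚ.≤-trans 0≤p p≤q) (^-mono k 0≤p p≤q))

1≤^ : ∀ {p} k → 1ℚ ℚ.≤ p → 1ℚ ℚ.≤ p ^ℚ k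
1≤^ {p} zero 1≤p = ℚₚ.≤-refl
1≤^ {p} (suc k) 1≤p = ℚₚ.≤-trans 1≤p (subst (ℚ._≤ p ℚ.* p ^ℚ k) (ℚₚ.*-identityʳ p)
  (*-monoʳ p (ℚₚ.≤-trans (ℚₚ.<⇒≤ (ℚₚ.positive⁻¹ 1ℚ)) 1≤p) (1≤^ k 1≤p)))

ι-^ : ∀ a k → ι (a ^ k) ≡ ι a ^ℚ k
ι-^ a zero = refl
ι-^ a (suc k) = trans (ι-* a (a ^ k)) (cong (ι a ℚ.*_) (ι-^ a k))

seq-^ℝ : ∀ x k i → seq (x ^ℝ k) i ≡ seq x i ^ℚ k
seq-^ℝ x zero i = refl
seq-^ℝ x (suc k) i = cong (seq x i ℚ.*_) (seq-^ℝ x k i)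

-- The factor 14 is absorbed by eight more powers of y, as 14 ≤ (3/2)⁸.
≤14*⇒^≤^ : ∀ {p y} k → pos 3 ℚ./ 2 ℚ.≤ y → 0ℚ ℚ.≤ p → p ℚ.≤ ι 14 ℚ.* y → p ^ℚ k ℚ.≤ y ^ℚ (9 * k)
≤14*⇒^≤^ {p} {y} k 3/2≤y 0≤p p≤14y = subst (p ^ℚ k ℚ.≤_) (^-assocʳ y 9 k) (^-mono k 0≤p (begin
  p                ≤⟨ p≤14y ⟩
  ι 14 ℚ.* y       ≤⟨ *-monoˡ y (ℚₚ.≤-trans 0≤3/2 3/2≤y)
                       (ℚₚ.≤-trans (toWitness {a? = ι 14 ℚₚ.≤? (pos 3 ℚ./ 2) ^ℚ 8} _)
                        (^-mono 8 0≤3/2 3/2≤y)) ⟩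
  y ^ℚ 8 ℚ.* y      ≡⟨ ℚₚ.*-comm (y ^ℚ 8) y ⟩
  y ^ℚ 9            ∎))
  where
  open ℚₚ.≤-Reasoning
  0≤3/2 : 0ℚ ℚ.≤ pos 3 ℚ./ 2
  0≤3/2 = ℚₚ.<⇒≤ (ℚₚ.positive⁻¹ _)

fraction-≤ : ∀ K s c b .{{_ : NonZero b}} → K * c ≤ s * b → ι K ℚ.* (pos c ℚ./ b) ℚ.≤ ι s
fraction-≤ K s c b h = *-cancelʳ (ι b) (0<ι b) (begin
  ι K ℚ.* (pos c ℚ./ b) ℚ.* ι b   ≡⟨ ℚₚ.*-assoc (ι K) (pos c ℚ./ b) (ι b) ⟩
  ι K ℚ.* ((pos c ℚ./ b) ℚ.* ι b) ≡⟨ cong (ι K ℚ.*_) (/-*ι c b) ⟩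
  ι K ℚ.* ι c                   ≡⟨ ι-* K c ⟨
  ι (K * c)                   ≤⟨ ι-mono h ⟩
  ι (s * b)                   ≡⟨ ι-* s b ⟩
  ι s ℚ.* ι b                   ∎)
  where open ℚₚ.≤-Reasoning

fraction-≤-* : ∀ K s c b .{{_ : NonZero b}} x → K * c ≤ s * b → 0ℚ ℚ.≤ x → 1ℚ ℚ.≤ ι K ℚ.* x →
               pos c ℚ./ b ℚ.≤ ι s ℚ.* x
fraction-≤-* K s c b x h 0≤x 1≤Kx = begin
  ℓ                     ≡⟨ ℚₚ.*-identityʳ ℓ ⟨
  ℓ ℚ.* 1ℚ              ≤⟨ *-monoʳ ℓ 0≤ℓ 1≤Kx ⟩
  ℓ ℚ.* (ι K ℚ.* x)     ≡⟨ ℚₚ.*-assoc ℓ (ι K) x ⟨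
  ℓ ℚ.* ι K ℚ.* x       ≡⟨ cong (ℚ._* x) (ℚₚ.*-comm ℓ (ι K)) ⟩
  ι K ℚ.* ℓ ℚ.* x       ≤⟨ *-monoˡ x 0≤x (fraction-≤ K s c b h) ⟩
  ι s ℚ.* x             ∎
  where
  open ℚₚ.≤-Reasoning
  ℓ = pos c ℚ./ b
  0≤ℓ : 0ℚ ℚ.≤ ℓ
  0≤ℓ = *-cancelʳ (ι b) (0<ι b) (subst₂ ℚ._≤_ (sym (ℚₚ.*-zeroˡ (ι b))) (sym (/-*ι c b)) (0≤ι c))

-- `K` is the floor of 1/r plus one. The upper bound keeps it within a constant factor of 1/r while
-- r is bounded.
archimedean : ∀ r → 0ℚ ℚ.< r → ∃[ K ] (1 ≤ K × 1ℚ ℚ.≤ ι K ℚ.* r × ι K ℚ.* r ℚ.≤ 1ℚ ℚ.+ r)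
archimedean r@(mkℚ (pos zero) _ _) 0<r with ℚ.positive 0<r
... | ()
archimedean r@(mkℚ ℤ.-[1+ _ ] _ _) 0<r with ℚ.positive 0<r
... | ()
archimedean r@(mkℚ +[1+ a ] d-1 _) 0<r = K , s≤s z≤n ,
  *-cancelʳ (ι d) (0<ι d) (begin
    1ℚ ℚ.* ι d         ≡⟨ ℚₚ.*-identityˡ (ι d) ⟩
    ι d                ≤⟨ ι-mono d≤ ⟩
    ι (K * suc a)    ≡⟨ Krd ⟨
    ι K ℚ.* r ℚ.* ι d  ∎) ,
  *-cancelʳ (ι d) (0<ι d) (begin
    ι K ℚ.* r ℚ.* ι d          ≡⟨ Krd ⟩
    ι (K * suc a)            ≤⟨ ι-mono ≤d ⟩
    ι (suc a + d)            ≡⟨ trans (ι-+ (suc a) d) (ℚₚ.+-comm (ι (suc a)) (ι d)) ⟩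
    ι d ℚ.+ ι (suc a)          ≡⟨ cong₂ ℚ._+_ (ℚₚ.*-identityˡ (ι d)) rd ⟨
    1ℚ ℚ.* ι d ℚ.+ r ℚ.* ι d   ≡⟨ ℚₚ.*-distribʳ-+ (ι d) 1ℚ r ⟨
    (1ℚ ℚ.+ r) ℚ.* ι d         ∎)
  where
  open ℚₚ.≤-Reasoning
  d K : ℕ
  d = suc d-1
  K = suc (d / suc a)
  rd : r ℚ.* ι d ≡ ι (suc a)
  rd = trans (cong (ℚ._* ι d) (sym (ℚₚ.↥p/↧p≡p r))) (/-*ι (suc a) d)
  Krd : ι K ℚ.* r ℚ.* ι d ≡ ι (K * suc a)
  Krd = trans (ℚₚ.*-assoc (ι K) r (ι d)) (trans (cong (ι K ℚ.*_) rd) (sym (ι-* K (suc a))))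
  d≤ : d ≤ K * suc a
  d≤ = subst (_≤ K * suc a) (sym (m≡m%n+[m/n]*n d (suc a))) (+-monoˡ-≤ (d / suc a * suc a) (m%n≤n d (suc a)))
  ≤d : K * suc a ≤ suc a + d
  ≤d = +-monoʳ-≤ (suc a) (m/n*n≤m d (suc a))

-- An integer of the order of the inverse of a positive real

Eventually : (ℕ → Set) → Set
Eventually P = ∃[ N ] (∀ i → N ≤ i → P i)

≤ℝ-eventually : ∀ {x y} → Eventually (λ i → seq x i ℚ.≤ seq y i) → x ≤ℝ y
≤ℝ-eventually {x} {y} (N , h) = eventually-≤⇒≤ℝ {x} {y} N h

-- The bounds are read off at one index `i` of the Cauchy sequences, while `K` has to be the same
-- for all late indices.
record Scale (x : ℝ) (0<x : 0ℝ <ℝ x) (K : ℕ) (i : ℕ) : Set where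
  field
    0≤x    : 0ℚ ℚ.≤ seq x i
    1≤Kx   : 1ℚ ℚ.≤ ι K ℚ.* seq x i
    K≤7x⁻¹ : ι K ℚ.≤ ι 7 ℚ.* seq (x ⁻¹[ 0<x ]) i
    0≤x⁻¹  : 0ℚ ℚ.≤ seq (x ⁻¹[ 0<x ]) i
    x*x⁻¹  : seq x i ℚ.* seq (x ⁻¹[ 0<x ]) i ≡ 1ℚ

-- Here r is half of a late term e, and all later terms are within δ/2 ≤ r of e, hence between r and
-- 3r. With `K` from `archimedean` for r, such a term p has Kp ≤ 3Kr ≤ 3(1 + r) ≤ 3(1 + 4/3) = 7.
scale : ∀ x 0<x → Eventually (λ i → seq x i ℚ.≤ pos 4 ℚ./ 3) → ∃[ K ] (1 ≤ K × Eventually (Scale x 0<x K))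
scale x 0<x@(δ , 0<δ , N , 0+δ≤x) (N₂ , x≤4/3) = K , 1≤K , (N ⊔ N₁) ⊔ N₂ , λ i le →
  let N≤i = m⊔n≤o⇒m≤o N N₁ (m⊔n≤o⇒m≤o (N ⊔ N₁) N₂ le)
      N₁≤i = m⊔n≤o⇒n≤o N N₁ (m⊔n≤o⇒m≤o (N ⊔ N₁) N₂ le)
      N₂≤i = m⊔n≤o⇒n≤o (N ⊔ N₁) N₂ le
      p = seq x i
      δ≤p = subst (ℚ._≤ p) (ℚₚ.+-identityˡ δ) (0+δ≤x i N≤i)
      0<p = ℚₚ.<-≤-trans 0<δ δ≤p
      0≤p = ℚₚ.<⇒≤ 0<p
      r≤p = lower p (close⇒≤ e p (close M i (m≤n⊔m N N₁) N₁≤i))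
      p≤3r = upper p (close⇒≤ p e (close i M N₁≤i (m≤n⊔m N N₁)))
      inv = seq (x ⁻¹[ 0<x ]) i
      0<δ⊔p = ℚₚ.<-≤-trans 0<δ (ℚₚ.p≤p⊔q δ p)
      -- At these indices the clamp at δ in the definition of the inverse is inactive.
      p*inv = trans (cong (ℚ._* inv) (sym (ℚₚ.p≤q⇒p⊔q≡q δ≤p)))
                (ℚₚ.*-inverseʳ (δ ℚ.⊔ p) {{ℚ.>-nonZero 0<δ⊔p}})
      0≤inv = ℚₚ.<⇒≤ (ℚₚ.positive⁻¹ inv {{ℚₚ.1/pos⇒pos (δ ℚ.⊔ p) {{ℚ.positive 0<δ⊔p}}}})
  in record
    { 0≤x = 0≤p
    ; 1≤Kx = ℚₚ.≤-trans 1≤Kr (*-monoʳ (ι K) (0≤ι K) r≤p)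
    ; K≤7x⁻¹ = K≤7 p inv r≤p p≤3r (x≤4/3 i N₂≤i) p*inv 0≤inv
    ; 0≤x⁻¹ = 0≤inv
    ; x*x⁻¹ = p*inv
    }
  where
  stable = cauchy x (½ ℚ.* δ) (0<½* 0<δ)
  N₁ M : ℕ
  N₁ = proj₁ stable
  M = N ⊔ N₁
  close = proj₂ stable
  e r : ℚ
  e = seq x M
  r = ½ ℚ.* e
  δ≤e : δ ℚ.≤ e
  δ≤e = subst (ℚ._≤ e) (ℚₚ.+-identityˡ δ) (0+δ≤x M (m≤m⊔n N N₁))
  0<r : 0ℚ ℚ.< r
  0<r = 0<½* (ℚₚ.<-≤-trans 0<δ δ≤e)
  ½δ≤r : ½ ℚ.* δ ℚ.≤ r
  ½δ≤r = *-monoʳ ½ (ℚₚ.<⇒≤ (ℚₚ.positive⁻¹ ½)) δ≤e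
  r+r≡e : r ℚ.+ r ≡ e
  r+r≡e = ½δ+½δ≡δ e
  open ℚₚ.≤-Reasoning
  lower : ∀ p → e ℚ.≤ p ℚ.+ ½ ℚ.* δ → r ℚ.≤ p
  lower p h = ℚₚ.≮⇒≥ λ p<r → ℚₚ.<-irrefl refl (begin-strict
    e              ≤⟨ h ⟩
    p ℚ.+ ½ ℚ.* δ  <⟨ ℚₚ.+-mono-<-≤ p<r ½δ≤r ⟩
    r ℚ.+ r        ≡⟨ r+r≡e ⟩
    e              ∎)
  upper : ∀ p → p ℚ.≤ e ℚ.+ ½ ℚ.* δ → p ℚ.≤ ι 3 ℚ.* r
  upper p h = begin
    p                  ≤⟨ h ⟩
    e ℚ.+ ½ ℚ.* δ      ≤⟨ ℚₚ.+-mono-≤ (ℚₚ.≤-reflexive (sym r+r≡e)) ½δ≤r ⟩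
    r ℚ.+ r ℚ.+ r      ≡⟨ solve 1 (λ r → r :+ r :+ r := con (ι 3) :* r) refl r ⟩
    ι 3 ℚ.* r          ∎
    where open Data.Rational.Solver.+-*-Solver
  K = proj₁ (archimedean r 0<r)
  1≤K = proj₁ (proj₂ (archimedean r 0<r))
  1≤Kr = proj₁ (proj₂ (proj₂ (archimedean r 0<r)))
  Kr≤ = proj₂ (proj₂ (proj₂ (archimedean r 0<r)))
  K≤7 : ∀ p inv → r ℚ.≤ p → p ℚ.≤ ι 3 ℚ.* r → p ℚ.≤ pos 4 ℚ./ 3 → p ℚ.* inv ≡ 1ℚ → 0ℚ ℚ.≤ inv → ι K ℚ.≤ ι 7 ℚ.* inv
  K≤7 p inv r≤p p≤3r p≤4/3 p*inv 0≤inv = begin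
    ι K                     ≡⟨ ℚₚ.*-identityʳ (ι K) ⟨
    ι K ℚ.* 1ℚ              ≡⟨ cong (ι K ℚ.*_) p*inv ⟨
    ι K ℚ.* (p ℚ.* inv)     ≡⟨ ℚₚ.*-assoc (ι K) p inv ⟨
    ι K ℚ.* p ℚ.* inv       ≤⟨ *-monoˡ inv 0≤inv (begin
      ι K ℚ.* p                   ≤⟨ *-monoʳ (ι K) (0≤ι K) p≤3r ⟩
      ι K ℚ.* (ι 3 ℚ.* r)         ≡⟨ solve 2 (λ K r → K :* (con (ι 3) :* r) := con (ι 3) :* (K :* r)) refl (ι K) r ⟩
      ι 3 ℚ.* (ι K ℚ.* r)         ≤⟨ *-monoʳ (ι 3) (0≤ι 3) Kr≤ ⟩
      ι 3 ℚ.* (1ℚ ℚ.+ r)          ≤⟨ *-monoʳ (ι 3) (0≤ι 3) (ℚₚ.+-monoʳ-≤ 1ℚ (ℚₚ.≤-trans r≤p p≤4/3)) ⟩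
      ι 7                         ∎) ⟩
    ι 7 ℚ.* inv             ∎
    where open Data.Rational.Solver.+-*-Solver

-- Real bounds

power-bound : ∀ {size} s Z k {y} → size ≤ s * Z ^ k → pos 3 ℚ./ 2 ℚ.≤ y → ι Z ℚ.≤ ι 14 ℚ.* y →
              ι size ℚ.≤ ι s ℚ.* y ^ℚ (9 * k)
power-bound {size} s Z k {y} size≤ 3/2≤y Z≤ = begin
  ι size                      ≤⟨ ι-mono size≤ ⟩
  ι (s * Z ^ k)           ≡⟨ trans (ι-* s (Z ^ k)) (cong (ι s ℚ.*_) (ι-^ Z k)) ⟩
  ι s ℚ.* ι Z ^ℚ k             ≤⟨ *-monoʳ (ι s) (0≤ι s) (≤14*⇒^≤^ k 3/2≤y (0≤ι Z) Z≤) ⟩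
  ι s ℚ.* y ^ℚ (9 * k)       ∎
  where open ℚₚ.≤-Reasoning

≤⇒≤inverse : ∀ {x x⁻¹} a b → x ℚ.≤ a → x ℚ.* x⁻¹ ≡ 1ℚ → 0ℚ ℚ.≤ x⁻¹ → 0ℚ ℚ.≤ b → b ℚ.* a ℚ.≤ 1ℚ → b ℚ.≤ x⁻¹
≤⇒≤inverse {x} {x⁻¹} a b x≤a eq 0≤x⁻¹ 0≤b ba≤1 = begin
  b                     ≡⟨ trans (cong (b ℚ.*_) eq) (ℚₚ.*-identityʳ b) ⟨
  b ℚ.* (x ℚ.* x⁻¹)     ≡⟨ ℚₚ.*-assoc b x x⁻¹ ⟨
  b ℚ.* x ℚ.* x⁻¹       ≤⟨ *-monoˡ x⁻¹ 0≤x⁻¹ (ℚₚ.≤-trans (*-monoʳ b 0≤b x≤a) ba≤1) ⟩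
  1ℚ ℚ.* x⁻¹            ≡⟨ ℚₚ.*-identityˡ x⁻¹ ⟩
  x⁻¹                   ∎
  where open ℚₚ.≤-Reasoning

2nK≤14ny : ∀ n K {y} → ι K ℚ.≤ ι 7 ℚ.* y → ι (2 * n * K) ℚ.≤ ι 14 ℚ.* (ι n ℚ.* y)
2nK≤14ny n K {y} K≤7y = begin
  ι (2 * n * K)             ≡⟨ ι-* (2 * n) K ⟩
  ι (2 * n) ℚ.* ι K           ≤⟨ *-monoʳ (ι (2 * n)) (0≤ι (2 * n)) K≤7y ⟩
  ι (2 * n) ℚ.* (ι 7 ℚ.* y)   ≡⟨ cong (ℚ._* (ι 7 ℚ.* y)) (ι-* 2 n) ⟩
  ι 2 ℚ.* ι n ℚ.* (ι 7 ℚ.* y)   ≡⟨ solve 2 (λ n y → con (ι 2) :* n :* (con (ι 7) :* y) := con (ι 14) :* (n :* y))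
                                     refl (ι n) y ⟩
  ι 14 ℚ.* (ι n ℚ.* y)          ∎
  where
  open ℚₚ.≤-Reasoning
  open Data.Rational.Solver.+-*-Solver

≤ι* : ∀ n {p y} → 1 ≤ n → 0ℚ ℚ.≤ y → p ℚ.≤ y → p ℚ.≤ ι n ℚ.* y
≤ι* n {p} {y} 1≤n 0≤y p≤y = ℚₚ.≤-trans p≤y (subst (ℚ._≤ ι n ℚ.* y) (ℚₚ.*-identityˡ y) (*-monoˡ y 0≤y (ι-mono 1≤n)))

dimension-positive : ∀ {n} (U V : Subset n) → Disjoint U V → Nonempty U → Nonempty V → Fin n
dimension-positive {zero} U V disjoint ([] , u∈) ([] , v∈) = ⊥-elim (disjoint [] u∈ v∈)
dimension-positive {suc n} U V disjoint _ _ = zero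

locality-≤ : ∀ {n} (U V : Subset n) (D : CLO U V) U≠∅ V≠∅ K s x → K * card (CLO.oracleUnion D) ≤ s * card (U ⊗ V) →
  0ℚ ℚ.≤ x → 1ℚ ℚ.≤ ι K ℚ.* x → CLO.locality D U≠∅ V≠∅ ℚ.≤ ι s ℚ.* x
locality-≤ U V D U≠∅ V≠∅ K s x =
  fraction-≤-* K s (card (CLO.oracleUnion D)) (card (U ⊗ V)) {{card-⊗-nonZero U V U≠∅ V≠∅}} x

-- The order of a real and 1 cannot be decided, so the cases overlap. A term within 1/6 of all later
-- ones is compared with 7/6, the midpoint of 1 and 4/3.
≥1⊎≤4/3 : ∀ x → Eventually (λ i → 1ℚ ℚ.≤ seq x i) ⊎ Eventually (λ i → seq x i ℚ.≤ pos 4 ℚ./ 3)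
≥1⊎≤4/3 x with cauchy x (pos 1 ℚ./ 6) (ℚₚ.positive⁻¹ _)
... | N , close with ℚₚ.≤-total (pos 7 ℚ./ 6) (seq x N)
... | inj₁ 7/6≤ = inj₁ (N , λ i N≤i → ℚₚ.≮⇒≥ λ xᵢ<1 → ℚₚ.<-irrefl refl (begin-strict
    pos 7 ℚ./ 6              ≤⟨ 7/6≤ ⟩
    seq x N                ≤⟨ close⇒≤ (seq x N) (seq x i) (close N i ≤-refl N≤i) ⟩
    seq x i ℚ.+ pos 1 ℚ./ 6  <⟨ ℚₚ.+-monoˡ-< (pos 1 ℚ./ 6) xᵢ<1 ⟩
    pos 7 ℚ./ 6              ∎))
  where open ℚₚ.≤-Reasoning
... | inj₂ ≤7/6 = inj₂ (N , λ i N≤i → begin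
    seq x i                ≤⟨ close⇒≤ (seq x i) (seq x N) (close i N N≤i ≤-refl) ⟩
    seq x N ℚ.+ pos 1 ℚ./ 6  ≤⟨ ℚₚ.+-monoˡ-≤ (pos 1 ℚ./ 6) ≤7/6 ⟩
    pos 4 ℚ./ 3              ∎)
  where open ℚₚ.≤-Reasoning

CLO-of-locality-sε : ∀ k → ApproximatingCLOs k →
  ∀ (n : ℕ) (U V : Subset n) → Disjoint U V → (U≠∅ : Nonempty U) (V≠∅ : Nonempty V) →
  (C : MonotoneRealCircuit n) → RealSeparates C U V → let s = fromℕ (Circuit.size C) in
  (ε : ℝ) (0<ε : 0ℝ <ℝ ε) → ε <ℝ ½ℝ →
  Σ[ D ∈ CLO U V ]
    ( fromℕ (CLO.size D) ≤ℝ s *ℝ (fromℕ n *ℝ ε ⁻¹[ 0<ε ]) ^ℝ (9 * k)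
    × fromℚ (CLO.locality D U≠∅ V≠∅) ≤ℝ s *ℝ ε )
CLO-of-locality-sε k approximating-CLO n U V disjoint U≠∅ V≠∅ C separates ε 0<ε (δ , 0<δ , N , ε+δ≤½) = D ,
  ≤ℝ-eventually {fromℕ (CLO.size D)} {fromℕ s *ℝ Y ^ℝ (9 * k)} (M ⊔ N , λ i le →
    let sc = scaled i (m⊔n≤o⇒m≤o M N le) in
    subst (λ z → ι (CLO.size D) ℚ.≤ ι s ℚ.* z) (sym (seq-^ℝ Y (9 * k) i))
      (power-bound s (2 * n * K) k size≤
        -- As ε ≤ 1/2, its inverse passes 3/2, the threshold above which powers of the base absorb
        -- the constant 14.
        (≤ι* n (1≤Fin p₀) (Scale.0≤x⁻¹ sc) (≤⇒≤inverse ½ (pos 3 ℚ./ 2) (ε≤½ i (m⊔n≤o⇒n≤o M N le))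
          (Scale.x*x⁻¹ sc) (Scale.0≤x⁻¹ sc)
          (toWitness {a? = 0ℚ ℚₚ.≤? pos 3 ℚ./ 2} _) (toWitness {a? = (pos 3 ℚ./ 2) ℚ.* ½ ℚₚ.≤? 1ℚ} _)))
        (2nK≤14ny n K (Scale.K≤7x⁻¹ sc)))) ,
  ≤ℝ-eventually {fromℚ (CLO.locality D U≠∅ V≠∅)} {fromℕ s *ℝ ε} (M , λ i le →
    let sc = scaled i le in locality-≤ U V D U≠∅ V≠∅ K s (seq ε i) card≤ (Scale.0≤x sc) (Scale.1≤Kx sc))
  where
  s : ℕ
  s = Circuit.size C
  p₀ = dimension-positive U V disjoint U≠∅ V≠∅
  Y = fromℕ n *ℝ ε ⁻¹[ 0<ε ]
  ε≤½ : ∀ i → N ≤ i → seq ε i ℚ.≤ ½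
  ε≤½ i le = ℚₚ.≤-trans (p≤p+δ (seq ε i) 0<δ) (ε+δ≤½ i le)
  scaling : ∃[ K ] (1 ≤ K × Eventually (Scale ε 0<ε K))
  scaling = scale ε 0<ε (N , λ i le → ℚₚ.≤-trans (ε≤½ i le) (toWitness {a? = ½ ℚₚ.≤? pos 4 ℚ./ 3} _))
  K M : ℕ
  K = proj₁ scaling
  M = proj₁ (proj₂ (proj₂ scaling))
  scaled : ∀ i → M ≤ i → Scale ε 0<ε K i
  scaled = proj₂ (proj₂ (proj₂ scaling))
  approx = approximating-CLO U V U≠∅ V≠∅ p₀ C separates K (proj₁ (proj₂ scaling))
  D : CLO U V
  D = proj₁ approx
  size≤ : CLO.size D ≤ s * (2 * n * K) ^ k
  size≤ = proj₁ (proj₂ approx)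
  card≤ : K * card (CLO.oracleUnion D) ≤ s * card (U ⊗ V)
  card≤ = proj₂ (proj₂ approx)

1≤1⊔^ℝ : ∀ y c → fromℕ 1 ≤ℝ (1ℝ ⊔ℝ y) ^ℝ c
1≤1⊔^ℝ y c = ≤ℝ-eventually {fromℕ 1} {(1ℝ ⊔ℝ y) ^ℝ c} (0 , λ i _ →
  subst (1ℚ ℚ.≤_) (sym (seq-^ℝ (1ℝ ⊔ℝ y) c i)) (1≤^ c (ℚₚ.p≤p⊔q 1ℚ (seq y i))))

MuBound : ℕ → ∀ n (U V : Subset n) → Nonempty U → Nonempty V → ℕ → (μ : ℝ) → 0ℝ <ℝ μ → Set
MuBound k n U V U≠∅ V≠∅ s μ 0<μ = Σ[ D ∈ CLO U V ]
  ( fromℕ (CLO.size D) ≤ℝ (1ℝ ⊔ℝ fromℕ n *ℝ fromℕ s *ℝ μ ⁻¹[ 0<μ ]) ^ℝ (9 * suc k)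
  × fromℚ (CLO.locality D U≠∅ V≠∅) ≤ℝ μ )

-- The construction is run with s K, where `K` is of order 1/μ, so that the factor s in the locality
-- cancels. The factor s in the size is at most `Z` and costs one more power. From n ≥ 2 and μ ≤ 4/3
-- the base n s/μ is at least 2 · 3/4 = 3/2, enough to absorb constants.
CLO-of-small-locality-μ : ∀ k → ApproximatingCLOs k →
  ∀ n → 2 ≤ n → (U V : Subset n) (U≠∅ : Nonempty U) (V≠∅ : Nonempty V) → Fin n →
  (C : MonotoneRealCircuit n) → RealSeparates C U V → ∀ μ 0<μ → Eventually (λ i → seq μ i ℚ.≤ pos 4 ℚ./ 3) →
  MuBound k n U V U≠∅ V≠∅ (Circuit.size C) μ 0<μ
CLO-of-small-locality-μ k approximating-CLO n 2≤n U V U≠∅ V≠∅ p₀ C separates μ 0<μ (N , μ≤4/3) = D ,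
  ≤ℝ-eventually {fromℕ (CLO.size D)} {Y ^ℝ (9 * suc k)} (M ⊔ N , λ i le →
    let sc = scaled i (m⊔n≤o⇒m≤o M N le)
        ns = ι n ℚ.* ι s
        y = seq Y i
        z = ns ℚ.* seq (μ ⁻¹[ 0<μ ]) i
        3/4≤inv = ≤⇒≤inverse (pos 4 ℚ./ 3) (pos 3 ℚ./ 4) (μ≤4/3 i (m⊔n≤o⇒n≤o M N le))
          (Scale.x*x⁻¹ sc) (Scale.0≤x⁻¹ sc)
          (toWitness {a? = 0ℚ ℚₚ.≤? pos 3 ℚ./ 4} _) (toWitness {a? = (pos 3 ℚ./ 4) ℚ.* (pos 4 ℚ./ 3) ℚₚ.≤? 1ℚ} _)
        3/2≤z = ℚₚ.≤-trans
          (*-monoˡ (pos 3 ℚ./ 4) (toWitness {a? = 0ℚ ℚₚ.≤? pos 3 ℚ./ 4} _)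
            (ι-mono (*-mono-≤ 2≤n (1≤Fin (Circuit.output C)))))
          (*-monoʳ (ι (n * s)) (0≤ι (n * s)) 3/4≤inv)
        z≤y = ℚₚ.p≤q⊔p 1ℚ z
    in subst (ι (CLO.size D) ℚ.≤_) (trans (ℚₚ.*-identityˡ (y ^ℚ (9 * suc k))) (sym (seq-^ℝ Y (9 * suc k) i)))
         (power-bound 1 Z (suc k) {y} size≤′
           (ℚₚ.≤-trans (subst (λ k → pos 3 ℚ./ 2 ℚ.≤ k ℚ.* seq (μ ⁻¹[ 0<μ ]) i) (ι-* n s) 3/2≤z) z≤y)
           (ℚₚ.≤-trans (Z≤ (seq (μ ⁻¹[ 0<μ ]) i) (Scale.K≤7x⁻¹ sc)) (*-monoʳ (ι 14) (0≤ι 14) z≤y)))) ,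
  ≤ℝ-eventually {fromℚ (CLO.locality D U≠∅ V≠∅)} {μ} (M , λ i le →
    let sc = scaled i le in
    subst (CLO.locality D U≠∅ V≠∅ ℚ.≤_) (ℚₚ.*-identityˡ (seq μ i))
      (locality-≤ U V D U≠∅ V≠∅ K 1 (seq μ i) card≤ (Scale.0≤x sc) (Scale.1≤Kx sc)))
  where
  s : ℕ
  s = Circuit.size C
  instance
    s≢0 : NonZero s
    s≢0 = >-nonZero (1≤Fin (Circuit.output C))
  Y = 1ℝ ⊔ℝ fromℕ n *ℝ fromℕ s *ℝ μ ⁻¹[ 0<μ ]
  scaling : ∃[ K ] (1 ≤ K × Eventually (Scale μ 0<μ K))
  scaling = scale μ 0<μ (N , μ≤4/3)
  K M Z : ℕ
  K = proj₁ scaling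
  M = proj₁ (proj₂ (proj₂ scaling))
  1≤K : 1 ≤ K
  1≤K = proj₁ (proj₂ scaling)
  Z = 2 * n * (s * K)
  scaled : ∀ i → M ≤ i → Scale μ 0<μ K i
  scaled = proj₂ (proj₂ (proj₂ scaling))
  approx = approximating-CLO U V U≠∅ V≠∅ p₀ C separates (s * K) (*-mono-≤ (1≤Fin (Circuit.output C)) 1≤K)
  D : CLO U V
  D = proj₁ approx
  s≤Z : s ≤ Z
  s≤Z = ≤-trans (m≤m*n s K {{>-nonZero 1≤K}}) (m≤n*m (s * K) (2 * n)
    {{>-nonZero (*-mono-≤ {1} {2} (s≤s z≤n) (≤-trans (s≤s z≤n) 2≤n))}})
  size≤′ : CLO.size D ≤ 1 * Z ^ suc k
  size≤′ = ≤-trans (proj₁ (proj₂ approx))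
    (≤-trans (*-monoˡ-≤ (Z ^ k) s≤Z) (≤-reflexive (sym (*-identityˡ (Z ^ suc k)))))
  card≤ : K * card (CLO.oracleUnion D) ≤ 1 * card (U ⊗ V)
  card≤ = ≤-trans (*-cancelˡ-≤ s (≤-trans (≤-reflexive (sym (*-assoc s K _))) (proj₂ (proj₂ approx))))
    (≤-reflexive (sym (*-identityˡ (card (U ⊗ V)))))
  Z≤ : ∀ y → ι K ℚ.≤ ι 7 ℚ.* y → ι Z ℚ.≤ ι 14 ℚ.* (ι n ℚ.* ι s ℚ.* y)
  Z≤ y h = subst₂ (λ a b → ι a ℚ.≤ ι 14 ℚ.* (b ℚ.* y))
    (trans (cong (_* K) (sym (*-assoc 2 n s))) (*-assoc (2 * n) s K)) (ι-* n s) (2nK≤14ny (n * s) K h)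

CLO-of-locality-μ : ∀ k → ApproximatingCLOs k → ∀ (n : ℕ) (U V : Subset n) → Disjoint U V →
  (U≠∅ : Nonempty U) (V≠∅ : Nonempty V) → UpwardClosed U ⊎ DownwardClosed V →
  (C : MonotoneRealCircuit n) → RealSeparates C U V → ∀ μ 0<μ → MuBound k n U V U≠∅ V≠∅ (Circuit.size C) μ 0<μ
CLO-of-locality-μ k approx n U V disjoint U≠∅ V≠∅ closed C separates μ 0<μ with ≥1⊎≤4/3 μ
... | inj₁ (N , 1≤μ) =
  oneRectangle U V , 1≤1⊔^ℝ (fromℕ n *ℝ fromℕ (Circuit.size C) *ℝ μ ⁻¹[ 0<μ ]) (9 * suc k) ,
  ≤ℝ-eventually {fromℚ (CLO.locality (oneRectangle U V) U≠∅ V≠∅)} {μ} (N , λ i le →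
    ℚₚ.≤-trans (subst (ℚ._≤ 1ℚ) (ℚₚ.*-identityˡ (CLO.locality (oneRectangle U V) U≠∅ V≠∅))
        (fraction-≤ 1 1 (card (CLO.oracleUnion (oneRectangle U V))) (card (U ⊗ V)) {{card-⊗-nonZero U V U≠∅ V≠∅}}
          (*-monoʳ-≤ 1 (oneRectangle-card U V))))
      (1≤μ i le))
CLO-of-locality-μ k approx zero U V disjoint U≠∅ V≠∅ closed C separates μ 0<μ | inj₂ small
  with () ← dimension-positive U V disjoint U≠∅ V≠∅
CLO-of-locality-μ k approx 1 U V disjoint U≠∅ V≠∅ closed C separates μ 0<μ@(δ , 0<δ , M , 0+δ≤μ) | inj₂ small =
  D , 1≤1⊔^ℝ (fromℕ 1 *ℝ fromℕ (Circuit.size C) *ℝ μ ⁻¹[ 0<μ ]) (9 * suc k) ,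
  ≤ℝ-eventually {fromℚ (CLO.locality D U≠∅ V≠∅)} {μ} (M , λ i le →
    ℚₚ.≤-trans (subst (ℚ._≤ 0ℚ) (ℚₚ.*-identityˡ (CLO.locality D U≠∅ V≠∅))
        (fraction-≤ 1 0 (card (CLO.oracleUnion D)) (card (U ⊗ V)) {{card-⊗-nonZero U V U≠∅ V≠∅}}
          (≤-reflexive (trans (*-identityˡ _) (count-false (cartesianProduct (cube 1) (cube 1)))))))
      (ℚₚ.≤-trans (p≤p+δ 0ℚ 0<δ) (0+δ≤μ i le)))
  where
  D : CLO U V
  D = oneInput U V disjoint U≠∅ V≠∅ closed
CLO-of-locality-μ k approx n@(suc (suc _)) U V disjoint U≠∅ V≠∅ closed C separates μ 0<μ | inj₂ small =
  CLO-of-small-locality-μ k approx n (s≤s (s≤s z≤n)) U V U≠∅ V≠∅ zero C separates μ 0<μ small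

lemma6p2 : (∃[ c ] (∀ (n : ℕ) (U V : Subset n) → Disjoint U V →
    (U≠∅ : Nonempty U) (V≠∅ : Nonempty V) →
    UpwardClosed U ⊎ DownwardClosed V →
    (C : MonotoneRealCircuit n) → RealSeparates C U V →
    let s = fromℕ (Circuit.size C) in
    (ε : ℝ) (0<ε : 0ℝ <ℝ ε) → ε <ℝ ½ℝ →
    Σ[ D ∈ CLO U V ]
    ( fromℕ (CLO.size D) ≤ℝ s *ℝ (fromℕ n *ℝ ε ⁻¹[ 0<ε ]) ^ℝ c
    × fromℚ (CLO.locality D U≠∅ V≠∅) ≤ℝ s *ℝ ε )))
    ×
    (∃[ c ] (∀ (n : ℕ) (U V : Subset n) → Disjoint U V →
    (U≠∅ : Nonempty U) (V≠∅ : Nonempty V) →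
    UpwardClosed U ⊎ DownwardClosed V →
    (C : MonotoneRealCircuit n) → RealSeparates C U V →
    let s = fromℕ (Circuit.size C) in
    (μ : ℝ) (0<μ : 0ℝ <ℝ μ) →
    Σ[ D ∈ CLO U V ]
    ( fromℕ (CLO.size D) ≤ℝ (1ℝ ⊔ℝ fromℕ n *ℝ s *ℝ μ ⁻¹[ 0<μ ]) ^ℝ c
    × fromℚ (CLO.locality D U≠∅ V≠∅) ≤ℝ μ )))
lemma6p2 =
  -- 15 is the exponent of 2nK in the circuit size, the second bound spends one more power on the
  -- factor s, and 9 trades the constant 14 for powers of the base.
  (9 * 15 , λ n U V disjoint U≠∅ V≠∅ _ → CLO-of-locality-sε 15 approximating-CLO n U V disjoint U≠∅ V≠∅) ,
  (9 * 16 , CLO-of-locality-μ 15 approximating-CLO)
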